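{- Let $n,k$ be integers with $2<2k\le n$ such that $\mathrm{Pet}(n,k)$ is not bipartite (equivalently, it is not the case that $n$ is even and $k$ is odd). Write $d=\gcd(n,k)$ and define the index set $$\mathrm{Ind}(n,k)=\begin{cases}\{t \mid t \text{ odd},\ 0\le t\le \min\{\tfrac{2k}{d},\ \lfloor\tfrac{(k-1)^2}{n}\rfloor+1\}\} & \text{if } k \text{ and } n \text{ are odd},\\ \{t\in\mathbb{Z} \mid 0<t\le \min\{\tfrac{2k}{d},\ \lfloor\tfrac{(k-1)^2}{n}\rfloor\}\} & \text{if } \tfrac{n}{d} \text{ is odd and } k \text{ is even},\\ \{t\in\mathbb{Z} \mid 0<t\le \min\{\tfrac{k}{d},\ \lfloor\tfrac{(k-1)^2}{n}\rfloor\}\} & \text{if } \tfrac{n}{d} \text{ and } k \text{ are even},\end{cases}$$ and $$\mathcal{G}=\bigcup_{t\in \mathrm{Ind}(n,k)}\Big\{\,tn+(1-k)\lfloor \tfrac{tn}{k}\rfloor+2,\ \ (1+k)\lceil \tfrac{tn}{k}\rceil-tn+2\,\Big\}.$$ Then, with $\mathbb{O}$ the set of odd integers, $$g_{odd}(\mathrm{Pet}(n,k))=\min\Big(\big(\{\tfrac{n}{d},\ k+3\}\cup\mathcal{G}\big)\cap\mathbb{O}\Big).$$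
   Context: For integers $n,k$ with $2<2k\le n$, the generalized Petersen graph $\mathrm{Pet}(n,k)$ has vertex set $\{u_0,\dots,u_{n-1}\}\cup\{v_0,\dots,v_{n-1}\}$ and edge set $\{u_iu_{i+1}\}\cup\{u_iv_i\}\cup\{v_iv_{i+k}\}$, $i\in\{0,\dots,n-1\}$, with indices taken modulo $n$. For a non-bipartite graph $G$, the odd girth $g_{odd}(G)$ is the length of a shortest odd cycle of $G$. -}

module Defs where

open import Data.Bool.Base using (Bool)
open import Data.Fin.Base using (Fin; toℕ)
open import Data.Fin.Properties using (nonZeroIndex; toℕ-fromℕ<)
open import Data.Integer.Base as ℤ using (ℤ; +_; 1ℤ)
import Data.Integer.Divisibility as ℤ
open import Data.Nat.Base
open import Data.Nat.Divisibility using (_∣_; _∤_; divides; >⇒∤)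
open import Data.Nat.DivMod
open import Data.Nat.GCD using (gcd; gcd[m,n]≢0)
open import Data.Nat.Properties
open import Data.Product.Base using (Σ-syntax; ∃; _×_; _,_)
open import Data.Sum.Base using (inj₁)
open import Function.Definitions using (Injective)
open import Level using (Level; 0ℓ)
open import Relation.Binary.Core using (Rel)
open import Relation.Binary.Construct.Closure.Symmetric
  using (SymClosure; fwd; bwd; symmetric)
open import Relation.Binary.Definitions using (Symmetric)
open import Relation.Binary.PropositionalEquality
open import Relation.Nullary using (¬_)
open import Relation.Unary using (Pred; _∈_; _∪_; _∩_; ｛_｝; ⋃)

Even Odd : Pred ℕ 0ℓ
Even m = 2 ∣ m
Odd  m = 2 ∤ m

𝕆 : Pred ℤ 0ℓ
𝕆 z = ¬ (+ 2 ℤ.∣ z)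

record IsLeast {a ℓ₁ ℓ₂ : Level} {A : Set a} (_≼_ : Rel A ℓ₁)
               (P : Pred A ℓ₂) (x : A) : Set (a Level.⊔ ℓ₁ Level.⊔ ℓ₂) where
  field
    member : x ∈ P
    least  : ∀ {y} → y ∈ P → x ≼ y

⌊_/_⌋ ⌈_/_⌉ : (m n : ℕ) .{{_ : NonZero n}} → ℕ
⌊ m / n ⌋ = m / n
⌈ m / n ⌉ = (m + (n ∸ 1)) / n

-- Addition modulo n.
infixl 6 _⊕_
_⊕_ : {n : ℕ} → Fin n → ℕ → Fin n
_⊕_ {n} i j = ((toℕ i + j) mod n) {{nonZeroIndex i}}

i≢i⊕j : ∀ {n j} (i : Fin n) → 0 < j → j < n → i ≢ i ⊕ j
i≢i⊕j {n} {j} i 0<j j<n i≡i⊕j = >⇒∤ {{>-nonZero 0<j}} j<n (divides q j≡q*n)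
  where
  instance
    n≢0 : NonZero n
    n≢0 = nonZeroIndex i
  s q : ℕ
  s = toℕ i + j
  q = s / n
  open ≡-Reasoning
  j≡q*n : j ≡ q * n
  j≡q*n = +-cancelˡ-≡ (toℕ i) j (q * n) (begin
    toℕ i + j            ≡⟨ m≡m%n+[m/n]*n s n ⟩
    s % n + q * n        ≡⟨ cong (_+ q * n) (toℕ-fromℕ< (m%n<n s n)) ⟨
    toℕ (i ⊕ j) + q * n  ≡⟨ cong (λ x → toℕ x + q * n) i≡i⊕j ⟨
    toℕ i + q * n        ∎)

record SimpleGraph : Set₁ where
  infix 4 _~_
  field
    Vertex : Set
    _~_    : Rel Vertex 0ℓ
    ~-sym  : Symmetric _~_
    ~⇒≢    : ∀ {x y} → x ~ y → x ≢ y

module _ (G : SimpleGraph) where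
  open SimpleGraph G

  Bipartite : Set
  Bipartite = Σ[ side ∈ (Vertex → Bool) ] (∀ {x y} → x ~ y → side x ≢ side y)

  record Cycle (ℓ : ℕ) : Set where
    field
      3≤ℓ       : 3 ≤ ℓ
      vertex    : Fin ℓ → Vertex
      injective : Injective _≡_ _≡_ vertex
      adjacent  : ∀ i → vertex i ~ vertex (i ⊕ 1)

  IsOddGirth : Pred ℕ 0ℓ
  IsOddGirth = IsLeast _≤_ (Odd ∩ Cycle)

module GeneralizedPetersen
  (n k : ℕ) (2<2k : 2 < 2 * k) (2k≤n : 2 * k ≤ n) where

  d : ℕ
  d = gcd n k

  private
    1<k : 1 < k
    1<k = *-cancelˡ-< 2 1 k 2<2k

    0<k : 0 < k
    0<k = <⇒≤ 1<k

    k<n : k < n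
    k<n = <-≤-trans (subst (k <_) (*-comm k 2) (m<m*n k 2 {{>-nonZero 0<k}} ≤-refl)) 2k≤n

    instance
      k≢0 : NonZero k
      k≢0 = >-nonZero 0<k

      n≢0 : NonZero n
      n≢0 = >-nonZero (<-trans 0<k k<n)

      d≢0 : NonZero d
      d≢0 = ≢-nonZero (gcd[m,n]≢0 n k (inj₁ (≢-nonZero⁻¹ n)))

  data V : Set where
    u v : Fin n → V

  data Edge : Rel V 0ℓ where
    uu : ∀ i → Edge (u i) (u (i ⊕ 1))
    uv : ∀ i → Edge (u i) (v i)
    vv : ∀ i → Edge (v i) (v (i ⊕ k))

  private
    u-injective : ∀ {i j} → u i ≡ u j → i ≡ j
    u-injective refl = refl

    v-injective : ∀ {i j} → v i ≡ v j → i ≡ j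
    v-injective refl = refl

    Edge⇒≢ : ∀ {x y} → Edge x y → x ≢ y
    Edge⇒≢ (uu i) eq = i≢i⊕j i ≤-refl (<-trans 1<k k<n) (u-injective eq)
    Edge⇒≢ (uv i) ()
    Edge⇒≢ (vv i) eq = i≢i⊕j i 0<k k<n (v-injective eq)

    adjacent⇒≢ : ∀ {x y} → SymClosure Edge x y → x ≢ y
    adjacent⇒≢ (fwd e) = Edge⇒≢ e
    adjacent⇒≢ (bwd e) = ≢-sym (Edge⇒≢ e)

  Pet : SimpleGraph
  Pet = record
    { Vertex = V
    ; _~_    = SymClosure Edge
    ; ~-sym  = symmetric Edge
    ; ~⇒≢    = adjacent⇒≢
    }

  n/d : ℕ
  n/d = n / d

  -- Every index is non-negative, so t ranges over ℕ.
  data Ind (t : ℕ) : Set where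
    odd-odd   : Odd k → Odd n → Odd t →
                t ≤ (2 * k / d) ⊓ (⌊ (k ∸ 1) ^ 2 / n ⌋ + 1) → Ind t
    odd-even  : Odd n/d → Even k → 0 < t →
                t ≤ (2 * k / d) ⊓ ⌊ (k ∸ 1) ^ 2 / n ⌋ → Ind t
    even-even : Even n/d → Even k → 0 < t →
                t ≤ (k / d) ⊓ ⌊ (k ∸ 1) ^ 2 / n ⌋ → Ind t

  𝒢 : Pred ℤ 0ℓ
  𝒢 = ⋃ (∃ Ind) λ (t , _) →
      ｛ + (t * n) ℤ.+ (1ℤ ℤ.- + k) ℤ.* + ⌊ t * n / k ⌋ ℤ.+ + 2 ｝
    ∪ ｛ (1ℤ ℤ.+ + k) ℤ.* + ⌈ t * n / k ⌉ ℤ.- + (t * n) ℤ.+ + 2 ｝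

-- A closed walk with net numbers a of outer and b of inner steps satisfies
-- a + b k = t n for some t, and its length has the parity of a + b and is at
-- least |a| + |b|, and at least |a| + |b| + 2 if it uses spokes.  For fixed t
-- the value of |a| + |b| is smallest when b is ⌊tn/k⌋ or ⌈tn/k⌉, which gives
-- the members of 𝒢.  Walks staying in one layer, and for odd n/d all walks
-- with t ≥ k/d, are at least as long as n/d; for even n/d and k, k/d can be
-- subtracted from t without changing the parity.  If tn > (k - 1)² and
-- a ≠ 0, then |a| + |b| ≥ k, so that k + 3 is at least as small for even k; for
-- odd k and tn > (k - 1)² + n the floor value of t = 1 plays this role.
-- Conversely every candidate is the length of a closed walk, and a shortest odd
-- closed walk is a cycle.

module Submission where

open import Defs
open import Algebra.Properties.AbelianGroup using (∙-cancelˡ)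
open import Data.Bool.Base using (Bool; true; false)
open import Data.Fin.Base using (Fin; toℕ)
open import Data.Fin.Properties using (toℕ-fromℕ<; toℕ<n; toℕ-injective; fromℕ<-cong)
open import Data.Integer.Base as ℤ using (ℤ; +_; -[1+_]; 0ℤ; 1ℤ)
import Data.Integer.Properties as ℤ
import Data.Integer.Tactic.RingSolver as ℤ-Solver
open import Data.Nat.Base
open import Data.Nat.Divisibility
open import Data.Nat.DivMod
open import Data.Nat.GCD
open import Data.Nat.Induction using (<-wellFounded; Acc; acc)
open import Data.Nat.Properties
import Data.Nat.Tactic.RingSolver as ℕ-Solver
open import Data.Parity.Base as ℙ using (Parity; 0ℙ; 1ℙ)
import Data.Parity.Properties as ℙ
open import Data.Product.Base using (∃; ∃-syntax; _×_; _,_; proj₂)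
open import Data.Sum.Base using (_⊎_; inj₁; inj₂)
open import Function.Bundles using (_⇔_; mk⇔; Equivalence)
open import Function.Definitions using (Injective)
open import Relation.Binary.Construct.Closure.Symmetric using (fwd; bwd)
open import Relation.Binary.Definitions using (tri<; tri≈; tri>)
open import Relation.Binary.PropositionalEquality
open import Relation.Nullary using (¬_; yes; no; contradiction)
open import Relation.Nullary.Decidable using (map′; _×-dec_; _⊎-dec_; ¬?)
open import Relation.Unary using (Pred; Decidable; _∈_; _∪_; _∩_; ｛_｝)

-- Parities, remainders and elementary inequalities.

parity≡0⇒even : ∀ m → parity m ≡ 0ℙ → Even m
parity≡0⇒even 0             _  = 2 ∣0
parity≡0⇒even (suc (suc m)) eq = ∣m∣n⇒∣m+n ∣-refl (parity≡0⇒even m eq)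

even⇒parity≡0 : ∀ {m} → Even m → parity m ≡ 0ℙ
even⇒parity≡0 (divides zero    refl) = refl
even⇒parity≡0 (divides (suc q) refl) = even⇒parity≡0 (divides q refl)

odd⇒parity≡1 : ∀ {m} → Odd m → parity m ≡ 1ℙ
odd⇒parity≡1 {m} odd with parity m in eq
... | 0ℙ = contradiction (parity≡0⇒even m eq) odd
... | 1ℙ = refl

parity≡1⇒odd : ∀ {m} → parity m ≡ 1ℙ → Odd m
parity≡1⇒odd eq even with () ← trans (sym eq) (even⇒parity≡0 even)

parity-suc : ∀ m → parity (suc m) ≡ parity m ℙ.⁻¹
parity-suc m = ℙ.+-homo-+ 1 m

toℕ-⊕ : ∀ {n} .{{_ : NonZero n}} (i : Fin n) j → toℕ (i ⊕ j) ≡ (toℕ i + j) % n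
toℕ-⊕ i j = toℕ-fromℕ< _

mod-⊕ : ∀ m j n .{{_ : NonZero n}} → (m mod n) ⊕ j ≡ (m + j) mod n
mod-⊕ m j n = toℕ-injective (begin
  toℕ ((m mod n) ⊕ j)    ≡⟨ toℕ-⊕ (m mod n) j ⟩
  (toℕ (m mod n) + j) % n ≡⟨ cong (λ x → (x + j) % n) (toℕ-fromℕ< (m%n<n m n)) ⟩
  (m % n + j) % n         ≡⟨ %-distribˡ-+ (m % n) j n ⟩
  (m % n % n + j % n) % n ≡⟨ cong (λ x → (x + j % n) % n) (m%n%n≡m%n m n) ⟩
  (m % n + j % n) % n     ≡⟨ %-distribˡ-+ m j n ⟨
  (m + j) % n             ≡⟨ toℕ-fromℕ< (m%n<n (m + j) n) ⟨
  toℕ ((m + j) mod n)     ∎)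
  where open ≡-Reasoning

m*n≤o⇒m≤o/n : ∀ m {n o} .{{_ : NonZero n}} → m * n ≤ o → m ≤ o / n
m*n≤o⇒m≤o/n m {n} {o} m*n≤o = subst (_≤ o / n) (m*n/n≡m m n) (/-monoˡ-≤ n m*n≤o)

m/n<o⇒m<o*n : ∀ m {n o} .{{_ : NonZero n}} → m / n < o → m < o * n
m/n<o⇒m<o*n m {n} {o} m/n<o = ≰⇒> λ o*n≤m → <⇒≱ m/n<o (m*n≤o⇒m≤o/n o o*n≤m)

[m+o*n]/n≡o : ∀ {m n} o .{{_ : NonZero n}} → m < n → (m + o * n) / n ≡ o
[m+o*n]/n≡o {m} {n} o m<n = begin
  (m + o * n) / n    ≡⟨ +-distrib-/-∣ʳ m (n∣m*n o) ⟩
  m / n + o * n / n  ≡⟨ cong₂ _+_ (m<n⇒m/n≡0 m<n) (m*n/n≡m o n) ⟩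
  o                  ∎
  where open ≡-Reasoning

parity-double : ∀ c b → parity (c + (b + b)) ≡ parity c
parity-double c zero    = cong parity (+-identityʳ c)
parity-double c (suc b) = trans (cong parity (shift c b)) (parity-double c b)
  where
  shift : ∀ c b → c + (suc b + suc b) ≡ suc (suc (c + (b + b)))
  shift = ℕ-Solver.solve-∀

odd-+-even : ∀ {m e} → Odd m → Even e → Odd (m + e)
odd-+-even {m} {e} odd even 2∣ = odd (∣m+n∣m⇒∣n (subst (2 ∣_) (+-comm m e) 2∣) even)

-- If α + β ≤ κ, then β ≤ κ - 1, and these give α + β (κ + 1) ≤ κ + (κ - 1) κ = κ².
κ²<⇒κ<+ : ∀ κ α β → 1 ≤ α → κ ^ 2 < α + β * suc κ → κ < α + β
κ²<⇒κ<+ κ (suc α) β _ κ²< = ≰⇒> λ +≤κ → <⇒≱ κ²< (begin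
  suc α + β * suc κ    ≡⟨ shuffle α β κ ⟩
  suc α + β + β * κ    ≤⟨ +-monoˡ-≤ (β * κ) +≤κ ⟩
  suc β * κ            ≤⟨ *-monoˡ-≤ κ (≤-trans (s≤s (m≤n+m β α)) +≤κ) ⟩
  κ * κ                ≡⟨ square κ ⟩
  κ ^ 2                ∎)
  where
  open ≤-Reasoning
  shuffle : ∀ α β κ → suc α + β * suc κ ≡ suc α + β + β * κ
  shuffle = ℕ-Solver.solve-∀
  square : ∀ κ → κ * κ ≡ κ ^ 2
  square κ = cong (κ *_) (sym (*-identityʳ κ))

-- If `α + β ≤ κ + q - 1`, then `α + β (κ + 1) ≤ (α + β) (κ + 1) ≤ (κ + q) (κ + 1) - (κ + 1) = κ² +
-- q (κ + 1) - 1`, which is less than `κ² + n`. It is applied with `κ = k - 1` and `q =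
-- ⌊n/k⌋`, where `κ + q` bounds the remainder plus the quotient of `n` by `k`.
κ²+<⇒≤+ : ∀ κ q α β {n} → q * suc κ ≤ n → κ ^ 2 + n < α + β * suc κ → κ + q ≤ α + β
κ²+<⇒≤+ κ q α β {n} qk≤n κ²+n< = ≮⇒≥ λ +<κ+q → <⇒≱ κ²+n< (begin
  α + β * suc κ          ≤⟨ m≤m+n _ (α * κ) ⟩
  α + β * suc κ + α * κ  ≡⟨ factor α β κ ⟩
  (α + β) * suc κ        ≤⟨ <⇒≤ (bound +<κ+q) ⟩
  κ ^ 2 + q * suc κ      ≤⟨ +-monoʳ-≤ (κ ^ 2) qk≤n ⟩
  κ ^ 2 + n              ∎)
  where
  open ≤-Reasoning
  factor : ∀ α β κ → α + β * suc κ + α * κ ≡ (α + β) * suc κ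
  factor = ℕ-Solver.solve-∀
  expand : ∀ κ q → (κ + q) * suc κ ≡ κ * (κ * 1) + q * suc κ + κ
  expand = ℕ-Solver.solve-∀
  bound : α + β < κ + q → (α + β) * suc κ < κ ^ 2 + q * suc κ
  bound +<κ+q = +-cancelʳ-≤ κ _ _ (begin
    suc ((α + β) * suc κ) + κ  ≡⟨ cong suc (+-comm _ κ) ⟩
    suc (α + β) * suc κ        ≤⟨ *-monoˡ-≤ (suc κ) +<κ+q ⟩
    (κ + q) * suc κ            ≡⟨ expand κ q ⟩
    κ ^ 2 + q * suc κ + κ      ∎)

-- A unit step `δ` added to the net count `a` either increases the absolute value or cancels an
-- opposite step; `e` is 1 exactly in the second case, when two steps disappear from the net count.
suc-∣∣ : ∀ δ a → ℤ.∣ δ ∣ ≡ 1 → ∃[ e ] suc ℤ.∣ a ∣ ≡ ℤ.∣ δ ℤ.+ a ∣ + (e + e)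
suc-∣∣ (+ 1) (+ m)            _ = 0 , sym (+-identityʳ _)
suc-∣∣ (+ 1) -[1+ zero ]      _ = 1 , refl
suc-∣∣ (+ 1) -[1+ suc m ]     _ = 1 , +-comm 2 (suc m)
suc-∣∣ -[1+ 0 ] (+ zero)      _ = 0 , refl
suc-∣∣ -[1+ 0 ] (+ suc m)     _ = 1 , +-comm 2 m
suc-∣∣ -[1+ 0 ] -[1+ m ]      _ = 0 , sym (+-identityʳ _)

-- Constructive descent: a bounded search below `m` either finds a smaller witness, from which the
-- search restarts, or certifies that `m` is minimal.
least : ∀ {p} {P : Pred ℕ p} → Decidable P → ∀ {m} → P m → ∃ (IsLeast _≤_ P)
least {P = P} P? {m} = go (<-wellFounded m)
  where
  go : ∀ {m} → Acc _<_ m → P m → ∃ (IsLeast _≤_ P)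
  go {m} (acc rec) Pm with anyUpTo? P? m
  ... | yes (i , i<m , Pi) = go (rec i<m) Pi
  ... | no  none           = m , record
    { member = Pm
    ; least  = λ {i} Pi → ≮⇒≥ λ i<m → none (i , i<m , Pi)
    }

-- Walks, closed walks and cycles in a simple graph.

module Walks (G : SimpleGraph) where
  open SimpleGraph G

  infixr 5 _∷_ _++_

  data Walk : Vertex → Vertex → ℕ → Set where
    []  : ∀ {x} → Walk x x 0
    _∷_ : ∀ {x y z ℓ} → x ~ y → Walk y z ℓ → Walk x z (suc ℓ)

  _++_ : ∀ {x y z ℓ m} → Walk x y ℓ → Walk y z m → Walk x z (ℓ + m)
  []      ++ q = q
  (e ∷ p) ++ q = e ∷ (p ++ q)

  reverse : ∀ {x y ℓ} → Walk x y ℓ → Walk y x ℓ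
  reverse []            = []
  reverse {ℓ = suc ℓ} (e ∷ p) =
    subst (Walk _ _) (+-comm ℓ 1) (reverse p ++ ~-sym e ∷ [])

  -- Past its end a walk is taken to rest at its last vertex, so positions are plain natural
  -- numbers.
  at : ∀ {x y ℓ} → Walk x y ℓ → ℕ → Vertex
  at {x}     _       zero    = x
  at {y = y} []      (suc i) = y
  at         (e ∷ p) (suc i) = at p i

  at-end : ∀ {x y ℓ} (p : Walk x y ℓ) → at p ℓ ≡ y
  at-end []      = refl
  at-end (e ∷ p) = at-end p

  at-step : ∀ {x y ℓ} (p : Walk x y ℓ) {i} → i < ℓ → at p i ~ at p (suc i)
  at-step (e ∷ p) {zero}  _         = e
  at-step (e ∷ p) {suc i} (s<s i<ℓ) = at-step p i<ℓ

  take : ∀ {x y ℓ} (p : Walk x y ℓ) {i} → i ≤ ℓ → Walk x (at p i) i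
  take p       {zero}  _         = []
  take (e ∷ p) {suc i} (s≤s i≤ℓ) = e ∷ take p i≤ℓ

  drop : ∀ {x y ℓ} (p : Walk x y ℓ) i → Walk (at p i) y (ℓ ∸ i)
  drop p       zero    = p
  drop []      (suc i) = []
  drop (e ∷ p) (suc i) = drop p i

  at-drop : ∀ {x y ℓ} (p : Walk x y ℓ) i m → at (drop p i) m ≡ at p (i + m)
  at-drop p       zero    m       = refl
  at-drop []      (suc i) zero    = refl
  at-drop []      (suc i) (suc m) = refl
  at-drop (e ∷ p) (suc i) m       = at-drop p i m

  -- A repeated vertex splits an odd closed walk into two shorter closed
  -- walks, one of which is odd.
  split-closed : ∀ {x ℓ} (p : Walk x x ℓ) {i j} → i < j → j < ℓ → at p i ≡ at p j → Odd ℓ →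
                 ∃[ y ] ∃[ m ] m < ℓ × Odd m × Walk y y m
  split-closed {x} {ℓ} p {i} {j} i<j j<ℓ eq odd with parity (j ∸ i) in j∸i
  ... | 1ℙ = at p i , j ∸ i , ≤-<-trans (m∸n≤m j i) j<ℓ , parity≡1⇒odd j∸i ,
             subst (λ y → Walk (at p i) y (j ∸ i))
                   (trans (at-drop p i (j ∸ i)) (trans (cong (at p) (m+[n∸m]≡n (<⇒≤ i<j))) (sym eq)))
                   (take (drop p i) (∸-monoˡ-≤ i (<⇒≤ j<ℓ)))
  ... | 0ℙ = x , i + (ℓ ∸ j) ,
             <-≤-trans (+-monoˡ-< (ℓ ∸ j) i<j) (≤-reflexive (m+[n∸m]≡n (<⇒≤ j<ℓ))) ,
             parity≡1⇒odd odd-rest ,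
             take p (<⇒≤ (<-trans i<j j<ℓ)) ++ subst (λ y → Walk y x (ℓ ∸ j)) (sym eq) (drop p j)
    where
    open ≡-Reasoning
    odd-rest : parity (i + (ℓ ∸ j)) ≡ 1ℙ
    odd-rest = begin
      parity (i + (ℓ ∸ j))                      ≡⟨ cong (ℙ._+ parity (i + (ℓ ∸ j))) j∸i ⟨
      parity (j ∸ i) ℙ.+ parity (i + (ℓ ∸ j))   ≡⟨ ℙ.+-homo-+ (j ∸ i) (i + (ℓ ∸ j)) ⟨
      parity (j ∸ i + (i + (ℓ ∸ j)))            ≡⟨ cong parity (+-assoc (j ∸ i) i (ℓ ∸ j)) ⟨
      parity (j ∸ i + i + (ℓ ∸ j))              ≡⟨ cong (λ m → parity (m + (ℓ ∸ j))) (m∸n+n≡m (<⇒≤ i<j)) ⟩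
      parity (j + (ℓ ∸ j))                      ≡⟨ cong parity (m+[n∸m]≡n (<⇒≤ j<ℓ)) ⟩
      parity ℓ                                  ≡⟨ odd⇒parity≡1 odd ⟩
      1ℙ                                        ∎

  odd-closed⇒3≤ : ∀ {x ℓ} → Walk x x ℓ → Odd ℓ → 3 ≤ ℓ
  odd-closed⇒3≤ {ℓ = 0} _        odd = contradiction (2 ∣0) odd
  odd-closed⇒3≤ {ℓ = 1} (e ∷ []) _   = contradiction refl (~⇒≢ e)
  odd-closed⇒3≤ {ℓ = 2} _        odd = contradiction ∣-refl odd
  odd-closed⇒3≤ {ℓ = suc (suc (suc ℓ))} _ _ = s≤s (s≤s (s≤s z≤n))

  -- A repeated vertex would yield a shorter odd closed walk by `split-closed`, and length 1 is
  -- excluded because adjacent vertices differ.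
  shortest-odd-closed⇒cycle : ∀ {x ℓ} → Walk x x ℓ → Odd ℓ →
    (∀ {y m} → Walk y y m → Odd m → ℓ ≤ m) → Cycle G ℓ
  shortest-odd-closed⇒cycle {x} {ℓ} p odd shortest = record
    { 3≤ℓ       = 3≤ℓ
    ; vertex    = λ i → at p (toℕ i)
    ; injective = inj
    ; adjacent  = adj
    }
    where
    3≤ℓ : 3 ≤ ℓ
    3≤ℓ = odd-closed⇒3≤ p odd
    instance
      ℓ≢0 : NonZero ℓ
      ℓ≢0 = >-nonZero (≤-trans (s≤s z≤n) 3≤ℓ)

    distinct : ∀ {i j} → i < j → j < ℓ → at p i ≢ at p j
    distinct i<j j<ℓ eq with _ , m , m<ℓ , odd-m , q ← split-closed p i<j j<ℓ eq odd =
      <⇒≱ m<ℓ (shortest q odd-m)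

    inj : Injective _≡_ _≡_ (λ (i : Fin ℓ) → at p (toℕ i))
    inj {i} {j} eq with <-cmp (toℕ i) (toℕ j)
    ... | tri< i<j _ _ = contradiction eq (distinct i<j (toℕ<n j))
    ... | tri≈ _ i≡j _ = toℕ-injective i≡j
    ... | tri> _ _ j<i = contradiction (sym eq) (distinct j<i (toℕ<n i))

    next : ∀ {i} → i < ℓ → at p (suc i) ≡ at p (suc i % ℓ)
    next {i} i<ℓ with m≤n⇒m<n∨m≡n i<ℓ
    ... | inj₁ 1+i<ℓ = cong (at p) (sym (m<n⇒m%n≡m 1+i<ℓ))
    -- The last position wraps around to 0, and the closed walk ends where it starts.
    ... | inj₂ 1+i≡ℓ = begin
      at p (suc i)     ≡⟨ cong (at p) 1+i≡ℓ ⟩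
      at p ℓ           ≡⟨ at-end p ⟩
      at p 0           ≡⟨ cong (at p) (n%n≡0 ℓ) ⟨
      at p (ℓ % ℓ)     ≡⟨ cong (λ m → at p (m % ℓ)) 1+i≡ℓ ⟨
      at p (suc i % ℓ) ∎
      where open ≡-Reasoning

    adj : ∀ i → at p (toℕ i) ~ at p (toℕ (i ⊕ 1))
    adj i = subst (at p (toℕ i) ~_)
      (trans (next (toℕ<n i))
             (cong (at p) (sym (trans (toℕ-⊕ i 1) (cong (_% ℓ) (+-comm (toℕ i) 1))))))
      (at-step p (toℕ<n i))

  path : (f : ℕ → Vertex) → (∀ i → f i ~ f (suc i)) → ∀ i m → Walk (f i) (f (i + m)) m
  path f step i zero    = subst (λ j → Walk (f i) (f j) 0) (sym (+-identityʳ i)) []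
  path f step i (suc m) =
    subst (λ j → Walk (f i) (f j) (suc m)) (sym (+-suc i m)) (step i ∷ path f step (suc i) m)

  -- The cycle is unrolled to an `ℓ`-periodic map `f` on ℕ, which makes the closing edge a step like
  -- any other.
  cycle⇒closed : ∀ {ℓ} → Cycle G ℓ → ∃[ x ] Walk x x ℓ
  cycle⇒closed {ℓ} c = f 0 , subst (λ x → Walk (f 0) x ℓ) f-ℓ (path f step 0 ℓ)
    where
    open Cycle c
    instance
      ℓ≢0 : NonZero ℓ
      ℓ≢0 = >-nonZero (≤-trans (s≤s z≤n) 3≤ℓ)
    f : ℕ → Vertex
    f i = vertex (i mod ℓ)
    step : ∀ i → f i ~ f (suc i)
    step i = subst (f i ~_)
      (cong vertex (trans (mod-⊕ i 1 ℓ) (cong (_mod ℓ) (+-comm i 1)))) (adjacent (i mod ℓ))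
    f-ℓ : f ℓ ≡ f 0
    f-ℓ = cong vertex (fromℕ<-cong (ℓ % ℓ) (0 % ℓ)
      (trans (n%n≡0 ℓ) (sym (m*n%n≡0 0 ℓ))) (m%n<n ℓ ℓ) (m%n<n 0 ℓ))

  -- Each edge flips the side, so the sides of the two ends of a walk differ by the parity of its
  -- length; for a closed walk this parity cancels to zero.
  bipartite⇒even-closed : Bipartite G → ∀ {x ℓ} → Walk x x ℓ → Even ℓ
  bipartite⇒even-closed (side , proper) {x} {ℓ} p =
    parity≡0⇒even ℓ (cancel (parity ℓ) (⟦ side x ⟧) (flips p))
    where
    ⟦_⟧ : Bool → Parity
    ⟦ true  ⟧ = 1ℙ
    ⟦ false ⟧ = 0ℙ

    flip : ∀ a b → a ≢ b → ⟦ a ⟧ ≡ ⟦ b ⟧ ℙ.⁻¹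
    flip true  true  a≢b = contradiction refl a≢b
    flip true  false _   = refl
    flip false true  _   = refl
    flip false false a≢b = contradiction refl a≢b

    flips : ∀ {x y m} → Walk x y m → ⟦ side x ⟧ ≡ parity m ℙ.+ ⟦ side y ⟧
    flips []      = refl
    flips {x} {y} {suc m} (_∷_ {y = z} e q) = begin
      ⟦ side x ⟧                     ≡⟨ flip (side x) (side z) (proper e) ⟩
      ⟦ side z ⟧ ℙ.⁻¹                ≡⟨ cong ℙ._⁻¹ (flips q) ⟩
      1ℙ ℙ.+ (parity m ℙ.+ ⟦ side y ⟧) ≡⟨ ℙ.+-assoc 1ℙ (parity m) ⟦ side y ⟧ ⟨
      (parity m ℙ.⁻¹) ℙ.+ ⟦ side y ⟧   ≡⟨ cong (ℙ._+ ⟦ side y ⟧) (parity-suc m) ⟨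
      parity (suc m) ℙ.+ ⟦ side y ⟧  ∎
      where open ≡-Reasoning

    cancel : ∀ p s → s ≡ p ℙ.+ s → p ≡ 0ℙ
    cancel 0ℙ s  _  = refl
    cancel 1ℙ 0ℙ ()
    cancel 1ℙ 1ℙ ()

-- Generalized Petersen graphs: divisibility and winding equations.

module Petersen (n k : ℕ) (2<2k : 2 < 2 * k) (2k≤n : 2 * k ≤ n) where
  open GeneralizedPetersen n k 2<2k 2k≤n

  1<k : 1 < k
  1<k = *-cancelˡ-< 2 1 k 2<2k

  k<n : k < n
  k<n = <-≤-trans (m<m+n k (≤-trans (<⇒≤ 1<k) (m≤m+n k 0))) 2k≤n

  instance
    k≢0 : NonZero k
    k≢0 = >-nonZero (<⇒≤ 1<k)

    n≢0 : NonZero n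
    n≢0 = >-nonZero (<-trans (<⇒≤ 1<k) k<n)

    d≢0 : NonZero d
    d≢0 = ≢-nonZero (gcd[m,n]≢0 n k (inj₁ (≢-nonZero⁻¹ n)))

  d∣n : d ∣ n
  d∣n = gcd[m,n]∣m n k

  d∣k : d ∣ k
  d∣k = gcd[m,n]∣n n k

  n/d∣n : n/d ∣ n
  n/d∣n = m/n∣m d∣n

  suc-k∸1 : suc (k ∸ 1) ≡ k
  suc-k∸1 = m+[n∸m]≡n (<⇒≤ 1<k)

  -- Both sides are the least common multiple of `n` and `k`: a cycle of `n/d` inner steps makes
  -- `k / d` turns.
  n/d*k≡k/d*n : n/d * k ≡ k / d * n
  n/d*k≡k/d*n = begin
    n / d * k  ≡⟨ *-comm (n / d) k ⟩
    k * (n / d)  ≡⟨ *-/-assoc k d∣n ⟨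
    k * n / d  ≡⟨ cong (_/ d) (*-comm k n) ⟩
    n * k / d  ≡⟨ *-/-assoc n d∣k ⟩
    n * (k / d)  ≡⟨ *-comm n (k / d) ⟩
    k / d * n  ∎
    where open ≡-Reasoning

  k/d≤2k/d : k / d ≤ 2 * k / d
  k/d≤2k/d = /-monoˡ-≤ d (m≤m+n k (k + 0))

  0<k/d : 0 < k / d
  0<k/d = m≥n⇒m/n>0 (∣⇒≤ d∣k)

  Candidates : Pred ℤ _
  Candidates = (｛ + n/d ｝ ∪ ｛ + (k + 3) ｝ ∪ 𝒢) ∩ 𝕆

  -- α and β are the absolute values of integers a and b with a + b k = ± t n.
  data Winding (t α β : ℕ) : Set where
    same  : α + β * k ≡ t * n → Winding t α β
    outer : α ≡ t * n + β * k → Winding t α β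
    inner : β * k ≡ t * n + α → Winding t α β

  -- The triangle inequality for `a + b k`.
  winding-≤ : ∀ {t α β} → Winding t α β → t * n ≤ α + β * k
  winding-≤ (same eq)                    = ≤-reflexive (sym eq)
  winding-≤ {t} {α} {β} (outer eq) =
    ≤-trans (≤-trans (m≤m+n (t * n) (β * k)) (≤-reflexive (sym eq))) (m≤m+n α (β * k))
  winding-≤ {t} {α} {β} (inner eq) =
    ≤-trans (≤-trans (m≤m+n (t * n) α) (≤-reflexive (sym eq))) (m≤n+m (β * k) α)

  -- Signs do not matter modulo 2: in the mixed cases the two sides differ by twice `β * k` or twice
  -- `α`.
  winding-parity : ∀ {t α β} → Winding t α β → parity (α + β * k) ≡ parity (t * n)
  winding-parity (same eq) = cong parity eq
  winding-parity {t} {α} {β} (outer eq) =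
    trans (cong parity (trans (cong (_+ β * k) eq) (+-assoc (t * n) (β * k) (β * k))))
          (parity-double (t * n) (β * k))
  winding-parity {t} {α} {β} (inner eq) =
    trans (cong parity (trans (cong (λ x → α + x) eq) (trans (+-comm α _) (+-assoc (t * n) α α))))
          (parity-double (t * n) α)

  parity-odd-* : Odd k → ∀ α β → parity (α + β * k) ≡ parity (α + β)
  parity-odd-* odd-k α β = begin
    parity (α + β * k)                       ≡⟨ ℙ.+-homo-+ α (β * k) ⟩
    parity α ℙ.+ parity (β * k)              ≡⟨ cong (parity α ℙ.+_) (ℙ.*-homo-* β k) ⟩
    parity α ℙ.+ (parity β ℙ.* parity k)     ≡⟨ cong (λ p → parity α ℙ.+ (parity β ℙ.* p)) (odd⇒parity≡1 odd-k) ⟩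
    parity α ℙ.+ (parity β ℙ.* 1ℙ)           ≡⟨ cong (parity α ℙ.+_) (ℙ.*-identityʳ (parity β)) ⟩
    parity α ℙ.+ parity β                    ≡⟨ ℙ.+-homo-+ α β ⟨
    parity (α + β)                           ∎
    where open ≡-Reasoning

  winding-parity-odd : Odd k → ∀ {t} α β → Winding t α β → parity (α + β) ≡ parity (t * n)
  winding-parity-odd odd-k α β w = trans (sym (parity-odd-* odd-k α β)) (winding-parity w)

  odd-winding⇒odd-tn : Odd k → ∀ {t α β} → Winding t α β → Odd (α + β) → Odd t × Odd n
  odd-winding⇒odd-tn odd-k {t} {α} {β} w odd =
    (λ e → odd-tn (∣m⇒∣m*n n e)) , (λ e → odd-tn (∣n⇒∣m*n t e))
    where
    odd-tn : Odd (t * n)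
    odd-tn = parity≡1⇒odd (trans (sym (winding-parity-odd odd-k α β w)) (odd⇒parity≡1 odd))

  -- `n` divides both `β n` and `β k`, hence their gcd `β d`; then `d` is cancelled.
  n∣β*k⇒n/d∣β : ∀ {β} → n ∣ β * k → n/d ∣ β
  n∣β*k⇒n/d∣β {β} n∣βk = m∣n*o⇒m/n∣o d∣n
    (subst (n ∣_) (sym (c*gcd[m,n]≡gcd[cm,cn] β n k)) (gcd-greatest (n∣m*n β) n∣βk))

  one-layer : ∀ {t α β} → Winding t α β → α ≡ 0 ⊎ β ≡ 0 → n/d ∣ α + β
  one-layer {t} {β = β} (same eq)  (inj₁ refl) = n∣β*k⇒n/d∣β (divides t eq)
  one-layer {t} {β = β} (outer eq) (inj₁ refl) =
    n∣β*k⇒n/d∣β (subst (n ∣_) (sym (m+n≡0⇒n≡0 (t * n) (sym eq))) (n ∣0))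
  one-layer {t} {β = β} (inner eq) (inj₁ refl) = n∣β*k⇒n/d∣β (divides t (trans eq (+-identityʳ _)))
  one-layer {t} (same eq)  (inj₂ refl) = ∣-trans n/d∣n (divides t eq)
  one-layer {t} (outer eq) (inj₂ refl) =
    ∣-trans n/d∣n (divides t (trans (+-identityʳ _) (trans eq (+-identityʳ _))))
  one-layer {t} {α} (inner eq) (inj₂ refl) =
    subst (n/d ∣_) (sym (trans (+-identityʳ α) (m+n≡0⇒n≡0 (t * n) (sym eq)))) (n/d ∣0)

  -- Lengths bounded below by a candidate.

  Dominated : ℕ → Set
  Dominated ℓ = ∃[ m ] + m ∈ Candidates × m ≤ ℓ

  n/d-dominates : ∀ {ℓ} → Odd n/d → n/d ≤ ℓ → Dominated ℓ
  n/d-dominates odd n/d≤ℓ = n/d , (inj₁ refl , odd) , n/d≤ℓ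

  -- Here `n/d` divides the odd, hence nonzero, number `α + β`; so it is odd itself and not larger.
  one-layer-dominated : ∀ {t α β} → Winding t α β → Odd (α + β) → α ≡ 0 ⊎ β ≡ 0 → Dominated (α + β)
  one-layer-dominated {t} {α} {β} w odd one =
    n/d-dominates (λ e → odd (∣-trans e n/d∣))
                  (∣⇒≤ {{≢-nonZero λ eq → odd (subst (2 ∣_) (sym eq) (2 ∣0))}} n/d∣)
    where
    n/d∣ : n/d ∣ α + β
    n/d∣ = one-layer w one

  k+3-dominates : ∀ {ℓ} → Even k → k + 3 ≤ ℓ → Dominated ℓ
  k+3-dominates even k+3≤ℓ =
    k + 3 , (inj₂ (inj₁ refl) , λ e → parity≡1⇒odd {3} refl (∣m+n∣m⇒∣n e even)) , k+3≤ℓ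

  -- Replacing `t n` by `α + β k` turns the first formula of `𝒢` into the length of a walk with `α`
  -- outer steps, `β` inner steps and two spokes. `ceiling-value` does the same for the second
  -- formula, where the outer steps run backwards.
  floor-value : ∀ {t α β} → α + β * k ≡ t * n → β ≡ ⌊ t * n / k ⌋ →
                + (t * n) ℤ.+ (1ℤ ℤ.- + k) ℤ.* + ⌊ t * n / k ⌋ ℤ.+ + 2 ≡ + (α + β + 2)
  floor-value {t} {α} {β} eq refl = begin
    + (t * n) ℤ.+ (1ℤ ℤ.- + k) ℤ.* + β ℤ.+ + 2               ≡⟨ cong (λ x → x ℤ.+ (1ℤ ℤ.- + k) ℤ.* + β ℤ.+ + 2) tn ⟩
    + α ℤ.+ + β ℤ.* + k ℤ.+ (1ℤ ℤ.- + k) ℤ.* + β ℤ.+ + 2     ≡⟨ ring (+ α) (+ β) (+ k) ⟩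
    + (α + β + 2)                                            ∎
    where
    open ≡-Reasoning
    tn : + (t * n) ≡ + α ℤ.+ + β ℤ.* + k
    tn = trans (cong (λ m → + m) (sym eq)) (cong (λ x → + α ℤ.+ x) (ℤ.pos-* β k))
    ring : ∀ α β k → α ℤ.+ β ℤ.* k ℤ.+ (1ℤ ℤ.- k) ℤ.* β ℤ.+ + 2 ≡ α ℤ.+ β ℤ.+ + 2
    ring = ℤ-Solver.solve-∀

  ceiling-value : ∀ {t α β} → β * k ≡ t * n + α → β ≡ ⌈ t * n / k ⌉ →
                  (1ℤ ℤ.+ + k) ℤ.* + ⌈ t * n / k ⌉ ℤ.- + (t * n) ℤ.+ + 2 ≡ + (α + β + 2)
  ceiling-value {t} {α} {β} eq refl = begin
    (1ℤ ℤ.+ + k) ℤ.* + β ℤ.- + (t * n) ℤ.+ + 2               ≡⟨ ring₁ (+ k) (+ β) (+ (t * n)) ⟩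
    + β ℤ.+ + β ℤ.* + k ℤ.- + (t * n) ℤ.+ + 2                ≡⟨ cong (λ x → + β ℤ.+ x ℤ.- + (t * n) ℤ.+ + 2) βk ⟩
    + β ℤ.+ (+ (t * n) ℤ.+ + α) ℤ.- + (t * n) ℤ.+ + 2        ≡⟨ ring₂ (+ α) (+ β) (+ (t * n)) ⟩
    + (α + β + 2)                                            ∎
    where
    open ≡-Reasoning
    βk : + β ℤ.* + k ≡ + (t * n) ℤ.+ + α
    βk = trans (sym (ℤ.pos-* β k)) (cong (λ m → + m) eq)
    ring₁ : ∀ k β N → (1ℤ ℤ.+ k) ℤ.* β ℤ.- N ℤ.+ + 2 ≡ β ℤ.+ β ℤ.* k ℤ.- N ℤ.+ + 2
    ring₁ = ℤ-Solver.solve-∀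
    ring₂ : ∀ α β N → β ℤ.+ (N ℤ.+ α) ℤ.- N ℤ.+ + 2 ≡ α ℤ.+ β ℤ.+ + 2
    ring₂ = ℤ-Solver.solve-∀

  floor-dominates : ∀ {t α β ℓ} → Ind t → α + β * k ≡ t * n → β ≡ ⌊ t * n / k ⌋ →
                    Odd (α + β) → α + β + 2 ≤ ℓ → Dominated ℓ
  floor-dominates {t} ind eq β≡ odd ≤ℓ =
    _ , (inj₂ (inj₂ ((t , ind) , inj₁ (floor-value {t} eq β≡))) , odd-+-even odd ∣-refl) , ≤ℓ

  ceiling-dominates : ∀ {t α β ℓ} → Ind t → β * k ≡ t * n + α → β ≡ ⌈ t * n / k ⌉ →
                      Odd (α + β) → α + β + 2 ≤ ℓ → Dominated ℓ
  ceiling-dominates {t} ind eq β≡ odd ≤ℓ =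
    _ , (inj₂ (inj₂ ((t , ind) , inj₂ (ceiling-value {t} eq β≡))) , odd-+-even odd ∣-refl) , ≤ℓ

  -- Floor and ceiling quotients minimise the length for fixed t.

  m%k≤k∸1 : ∀ m → m % k ≤ k ∸ 1
  m%k≤k∸1 m = s≤s⁻¹ (subst (m % k <_) (sym suc-k∸1) (m%n<n m k))

  N≤⌈N/k⌉*k : ∀ N → N ≤ ⌈ N / k ⌉ * k
  N≤⌈N/k⌉*k N = +-cancelʳ-≤ (k ∸ 1) _ _ (begin
    N + (k ∸ 1)                        ≡⟨ m≡m%n+[m/n]*n (N + (k ∸ 1)) k ⟩
    (N + (k ∸ 1)) % k + ⌈ N / k ⌉ * k  ≤⟨ +-monoˡ-≤ _ (m%k≤k∸1 (N + (k ∸ 1))) ⟩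
    (k ∸ 1) + ⌈ N / k ⌉ * k            ≡⟨ +-comm (k ∸ 1) _ ⟩
    ⌈ N / k ⌉ * k + (k ∸ 1)            ∎)
    where open ≤-Reasoning

  ⌈N/k⌉-≤ : ∀ {N β} → N ≤ β * k → ⌈ N / k ⌉ ≤ β
  ⌈N/k⌉-≤ {N} {β} N≤βk = s≤s⁻¹ (m<n*o⇒m/o<n (begin-strict
    N + (k ∸ 1)        ≤⟨ +-monoˡ-≤ (k ∸ 1) N≤βk ⟩
    β * k + (k ∸ 1)    <⟨ +-monoʳ-< (β * k) (≤-reflexive suc-k∸1) ⟩
    β * k + k          ≡⟨ +-comm (β * k) k ⟩
    suc β * k          ∎))
    where open ≤-Reasoning

  floor-winding : ∀ t → t * n % k + ⌊ t * n / k ⌋ * k ≡ t * n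
  floor-winding t = sym (m≡m%n+[m/n]*n (t * n) k)

  ceiling-winding : ∀ t → ⌈ t * n / k ⌉ * k ≡ t * n + (⌈ t * n / k ⌉ * k ∸ t * n)
  ceiling-winding t = sym (m+[n∸m]≡n (N≤⌈N/k⌉*k (t * n)))

  private
    κ : ℕ
    κ = k ∸ 1

  *k-split : ∀ q → q * k ≡ q + q * κ
  *k-split q = trans (cong (q *_) (sym suc-k∸1)) (*-suc q κ)

  -- The difference `(α + β) - (r + q)` equals `(q - β) (k - 1)`: trading `k` outer steps for one
  -- inner step saves `k - 1`.
  smaller-quotient : ∀ r q α β → r + q * k ≡ α + β * k → β ≤ q → r + q ≤ α + β
  smaller-quotient r q α β eq β≤q = +-cancelʳ-≤ (q * κ) _ _ (begin
    r + q + q * κ    ≡⟨ regroup r q ⟨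
    r + q * k        ≡⟨ eq ⟩
    α + β * k        ≡⟨ regroup α β ⟩
    α + β + β * κ    ≤⟨ +-monoʳ-≤ (α + β) (*-monoˡ-≤ κ β≤q) ⟩
    α + β + q * κ    ∎)
    where
    open ≤-Reasoning
    regroup : ∀ r q → r + q * k ≡ r + q + q * κ
    regroup r q = trans (cong (λ x → r + x) (*k-split q)) (sym (+-assoc r q (q * κ)))

  floor-shortest : ∀ {t α β} → α + β * k ≡ t * n → t * n % k + ⌊ t * n / k ⌋ ≤ α + β
  floor-shortest {t} {α} {β} eq = smaller-quotient (t * n % k) ⌊ t * n / k ⌋ α β
    (trans (floor-winding t) (sym eq))
    (m*n≤o⇒m≤o/n β (subst (β * k ≤_) eq (m≤n+m (β * k) α)))

  -- With backward inner steps there are at least `t n` outer ones, so the comparison passes through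
  -- the pair `(t n, 0)`.
  floor-shortest-outer : ∀ {t α β} → α ≡ t * n + β * k → t * n % k + ⌊ t * n / k ⌋ ≤ α + β
  floor-shortest-outer {t} {α} {β} eq = begin
    t * n % k + ⌊ t * n / k ⌋  ≤⟨ smaller-quotient (t * n % k) _ _ 0 floor-eq z≤n ⟩
    t * n + 0                  ≤⟨ +-monoʳ-≤ (t * n) z≤n ⟩
    t * n + β * k              ≡⟨ eq ⟨
    α                          ≤⟨ m≤m+n α β ⟩
    α + β                      ∎
    where
    open ≤-Reasoning
    floor-eq : t * n % k + ⌊ t * n / k ⌋ * k ≡ t * n + 0
    floor-eq = trans (floor-winding t) (sym (+-identityʳ (t * n)))

  -- Since `α = β k - t n` grows with `β`, both summands are smallest at the least possible `β`,
  -- which is the ceiling.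
  ceiling-shortest : ∀ {t α β} → β * k ≡ t * n + α →
                     ⌈ t * n / k ⌉ * k ∸ t * n + ⌈ t * n / k ⌉ ≤ α + β
  ceiling-shortest {t} {α} {β} eq = +-mono-≤
    (subst (⌈ t * n / k ⌉ * k ∸ t * n ≤_) (trans (cong (_∸ t * n) eq) (m+n∸m≡n (t * n) α))
           (∸-monoˡ-≤ (t * n) (*-monoˡ-≤ k ⌈⌉≤β)))
    ⌈⌉≤β
    where
    ⌈⌉≤β : ⌈ t * n / k ⌉ ≤ β
    ⌈⌉≤β = ⌈N/k⌉-≤ (subst (t * n ≤_) (sym eq) (m≤m+n (t * n) α))

  -- Odd windings are dominated: the cases of odd and even k.

  dominated-mono : ∀ {ℓ m} → ℓ ≤ m → Dominated ℓ → Dominated m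
  dominated-mono ℓ≤m (c , c∈ , c≤ℓ) = c , c∈ , ≤-trans c≤ℓ ℓ≤m

  -- After multiplication by `k`: `(n/d) k = (k/d) n ≤ t n ≤ α + β k ≤ (α + β) k`.
  n/d≤α+β : ∀ {t α β} → Winding t α β → k / d ≤ t → n/d ≤ α + β
  n/d≤α+β {t} {α} {β} w k/d≤t = *-cancelʳ-≤ n/d (α + β) k (begin
    n/d * k        ≡⟨ n/d*k≡k/d*n ⟩
    k / d * n      ≤⟨ *-monoˡ-≤ n k/d≤t ⟩
    t * n          ≤⟨ winding-≤ w ⟩
    α + β * k      ≤⟨ +-monoˡ-≤ (β * k) (m≤m*n α k) ⟩
    α * k + β * k  ≡⟨ *-distribʳ-+ k α β ⟨
    (α + β) * k    ∎)
    where open ≤-Reasoning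

  n/d-dominates-winding : ∀ {t α β} → Odd n/d → Winding t α β → k / d ≤ t → Dominated (α + β + 2)
  n/d-dominates-winding {t} {α} {β} odd w k/d≤t = n/d-dominates odd (≤-trans (n/d≤α+β w k/d≤t) (m≤m+n (α + β) 2))

  -- For odd `k` the parity of `α + β` is that of `t n`. So `t` and `n` are odd, and the floor and
  -- ceiling pairs for the same `t` are odd too: passing to the shortest pair never leaves the odd
  -- numbers.
  odd-k-dominated : ∀ {t α β} → Odd k → Winding t α β → Odd (α + β) → Dominated (α + β + 2)
  odd-k-dominated {t} {α} {β} odd-k w odd with odd-winding⇒odd-tn odd-k w odd
  ... | odd-t , odd-n = by-range
    where
    bound : ℕ
    bound = ⌊ (k ∸ 1) ^ 2 / n ⌋

    odd-n/d : Odd n/d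
    odd-n/d e = odd-n (∣-trans e n/d∣n)

    odd-length : ∀ {s} α β → Odd s → Winding s α β → Odd (α + β)
    odd-length {s} α β odd-s w = parity≡1⇒odd {α + β} (trans (winding-parity-odd odd-k α β w)
      (trans (ℙ.*-homo-* s n) (cong₂ ℙ._*_ (odd⇒parity≡1 odd-s) (odd⇒parity≡1 odd-n))))

    floor-dominated : ∀ {s ℓ} → Ind s → Odd s → s * n % k + ⌊ s * n / k ⌋ ≤ ℓ → Dominated (ℓ + 2)
    floor-dominated {s} ind odd-s ≤ℓ = floor-dominates ind (floor-winding s) refl
      (odd-length (s * n % k) _ odd-s (same (floor-winding s))) (+-monoˡ-≤ 2 ≤ℓ)

    in-range : Ind t → Winding t α β → Dominated (α + β + 2)
    in-range ind (same eq)  = floor-dominated ind odd-t (floor-shortest {t} {α} {β} eq)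
    in-range ind (outer eq) = floor-dominated ind odd-t (floor-shortest-outer {t} eq)
    in-range ind (inner eq) = ceiling-dominates ind (ceiling-winding t) refl
      (odd-length (⌈ t * n / k ⌉ * k ∸ t * n) _ odd-t (inner (ceiling-winding t))) (+-monoˡ-≤ 2 (ceiling-shortest {t} eq))

    1∈Ind : Ind 1
    1∈Ind = odd-odd odd-k odd-n (parity≡1⇒odd {1} refl) (⊓-glb (≤-trans 0<k/d k/d≤2k/d) (m≤n+m 1 bound))

    κ²+n<tn : bound + 1 < t → κ ^ 2 + 1 * n < t * n
    κ²+n<tn <t = begin-strict
      κ ^ 2 + 1 * n              <⟨ +-monoˡ-< (1 * n) (m/n<o⇒m<o*n (κ ^ 2) (m<m+n bound (s≤s z≤n))) ⟩
      (bound + 1) * n + 1 * n    ≡⟨ *-distribʳ-+ n (bound + 1) 1 ⟨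
      (bound + 1 + 1) * n        ≤⟨ *-monoˡ-≤ n (subst (_≤ t) (+-comm 1 (bound + 1)) <t) ⟩
      t * n                      ∎
      where open ≤-Reasoning

    -- The floor pair of `t = 1` is compared with a walk of many turns: its remainder is at most
    -- `k - 1`, and `t n > (k - 1)² + n` gives the rest.
    beyond-range : bound + 1 < t → 1 * n % k + ⌊ 1 * n / k ⌋ ≤ α + β
    beyond-range <t = ≤-trans
      (+-monoˡ-≤ _ (m%k≤k∸1 (1 * n)))
      (κ²+<⇒≤+ κ ⌊ 1 * n / k ⌋ α β
        (subst (λ x → ⌊ 1 * n / k ⌋ * x ≤ 1 * n) (sym suc-k∸1) (m/n*n≤m (1 * n) k))
        (<-≤-trans (κ²+n<tn <t) (subst (λ x → t * n ≤ α + β * x) (sym suc-k∸1) (winding-≤ w))))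

    by-range : Dominated (α + β + 2)
    by-range with t ≤? 2 * k / d | t ≤? bound + 1
    ... | yes t≤2k/d | yes t≤ = in-range (odd-odd odd-k odd-n odd-t (⊓-glb t≤2k/d t≤)) w
    -- Since `n` is odd, `n/d` is a candidate, and `t > 2k/d ≥ k/d` makes the walk at least that
    -- long.
    ... | no  t≰2k/d | _      = n/d-dominates-winding odd-n/d w (≤-trans k/d≤2k/d (<⇒≤ (≰⇒> t≰2k/d)))
    ... | yes _      | no  t≰ = floor-dominated 1∈Ind (parity≡1⇒odd {1} refl) (beyond-range (≰⇒> t≰))

  -- Fewer than `k` outer steps leave only the floor or the ceiling for `β`, and backward inner
  -- steps would force `α ≥ k`. The winding itself is thus the extremal one, so its oddness carries
  -- over directly.
  short-dominated : ∀ {t α β} → Ind t → Winding t α β → α < k → 0 < β → Odd (α + β) →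
                    Dominated (α + β + 2)
  short-dominated {t} {α} {β} ind (same eq) α<k _ odd = floor-dominates ind eq
    (trans (sym ([m+o*n]/n≡o β α<k)) (cong (_/ k) eq)) odd ≤-refl
  short-dominated {t} {α} {β} ind (outer refl) α<k 0<β _ =
    contradiction (≤-trans (m≤n*m k β {{>-nonZero 0<β}}) (m≤n+m (β * k) (t * n))) (<⇒≱ α<k)
  short-dominated {t} {α} {β} ind (inner eq) α<k _ odd = ceiling-dominates ind eq
    (≤-antisym (m*n≤o⇒m≤o/n β βk≤) (⌈N/k⌉-≤ (subst (t * n ≤_) (sym eq) (m≤m+n (t * n) α)))) odd ≤-refl
    where
    βk≤ : β * k ≤ t * n + κ
    βk≤ = ≤-trans (≤-reflexive eq) (+-monoʳ-≤ (t * n) (s≤s⁻¹ (subst (α <_) (sym suc-k∸1) α<k)))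

  -- For even `k`, changing `β` by one flips the parity of `α + β`, so the shortest pair for `t` may
  -- be even and cannot serve as a substitute. Instead `α ≥ k` and `β ≥ 1` already give length
  -- `k + 3`, and `α < k` pins `β` down. The recursion on `t` serves the case of even `n/d`.
  even-k-dominated : ∀ {t α β} → Acc _<_ t → Even k → Winding t α β → Odd (α + β) → Dominated (α + β + 2)
  even-k-dominated {t} {zero} {β} _ even-k w odd =
    dominated-mono (m≤m+n β 2) (one-layer-dominated w odd (inj₁ refl))
  even-k-dominated {t} {α} {zero} _ even-k w odd =
    dominated-mono (m≤m+n (α + 0) 2) (one-layer-dominated w odd (inj₂ refl))
  even-k-dominated {t} {α@(suc α′)} {β@(suc β′)} (acc rec) even-k w odd with k ≤? α
  ... | yes k≤α = k+3-dominates even-k (begin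
      k + 3          ≤⟨ +-monoˡ-≤ 3 k≤α ⟩
      α + 3          ≡⟨ +-assoc α 1 2 ⟨
      α + 1 + 2      ≤⟨ +-monoˡ-≤ 2 (+-monoʳ-≤ α (s≤s z≤n)) ⟩
      α + β + 2      ∎)
    where open ≤-Reasoning
  ... | no  k≰α = by-range
    where
    bound : ℕ
    bound = ⌊ (k ∸ 1) ^ 2 / n ⌋

    α<k : α < k
    α<k = ≰⇒> k≰α

    -- For `t = 0` the positive `α` and `β` satisfy `α = β k ≥ k`.
    0<t : 0 < t
    0<t = n≢0⇒n>0 λ { refl → positive w }
      where
      positive : ¬ Winding 0 α β
      positive (outer eq) = contradiction (≤-trans (m≤m+n k (β′ * k)) (≤-reflexive (sym eq))) k≰α
      positive (inner eq) = contradiction (≤-trans (m≤m+n k (β′ * k)) (≤-reflexive eq)) k≰α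

    beyond-bound : bound < t → k + 3 ≤ α + β + 2
    beyond-bound <t = begin
      k + 3          ≡⟨ +-assoc k 1 2 ⟨
      k + 1 + 2      ≤⟨ +-monoˡ-≤ 2 (subst (_≤ α + β) (+-comm 1 k) k<α+β) ⟩
      α + β + 2      ∎
      where
      open ≤-Reasoning
      k≤α+β : k ≤ α + β
      k≤α+β = subst (_≤ α + β) suc-k∸1 (κ²<⇒κ<+ κ α β (s≤s z≤n)
        (<-≤-trans (m/n<o⇒m<o*n (κ ^ 2) <t)
                   (subst (λ x → t * n ≤ α + β * x) (sym suc-k∸1) (winding-≤ w))))
      -- Parity gains the last unit: `k` is even and `α + β` is odd.
      k<α+β : k < α + β
      k<α+β = ≤∧≢⇒< k≤α+β λ eq → odd (subst (2 ∣_) eq even-k)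

    -- k/d turns around the cycle are undone by n/d steps of length k, an
    -- even number of them, so these can be dropped.
    unwind : Even n/d → k / d < t → Dominated (α + β + 2)
    unwind even-n/d k/d<t = dominated-mono (+-monoˡ-≤ 2 (+-monoʳ-≤ α (m∸n≤m β n/d)))
      (even-k-dominated (rec (∸-monoʳ-< 0<k/d (<⇒≤ k/d<t))) even-k (unwound w) odd′)
      where
      n/d≤β : n/d ≤ β
      -- Because `α < k`, the outer steps make up for less than one inner step, whence
      -- `n/d < β + 1`.
      n/d≤β = s≤s⁻¹ (*-cancelʳ-< k n/d (suc β) (begin-strict
        n/d * k         ≡⟨ n/d*k≡k/d*n ⟩
        k / d * n       ≤⟨ *-monoˡ-≤ n (<⇒≤ k/d<t) ⟩
        t * n           ≤⟨ winding-≤ w ⟩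
        α + β * k       <⟨ +-monoˡ-< (β * k) α<k ⟩
        suc β * k       ∎))
        where open ≤-Reasoning

      split-β : β * k ≡ k / d * n + (β ∸ n/d) * k
      split-β = begin
        β * k                              ≡⟨ cong (_* k) (m+[n∸m]≡n n/d≤β) ⟨
        (n/d + (β ∸ n/d)) * k              ≡⟨ *-distribʳ-+ k n/d (β ∸ n/d) ⟩
        n/d * k + (β ∸ n/d) * k            ≡⟨ cong (λ x → x + (β ∸ n/d) * k) n/d*k≡k/d*n ⟩
        k / d * n + (β ∸ n/d) * k          ∎
        where open ≡-Reasoning

      split-t : t * n ≡ k / d * n + (t ∸ k / d) * n
      split-t = trans (cong (_* n) (sym (m+[n∸m]≡n (<⇒≤ k/d<t)))) (*-distribʳ-+ n (k / d) (t ∸ k / d))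

      unwound : Winding t α β → Winding (t ∸ k / d) α (β ∸ n/d)
      unwound (same eq) = same (+-cancelˡ-≡ (k / d * n) _ _ (begin
        k / d * n + (α + (β ∸ n/d) * k)  ≡⟨ x+[y+z]≡y+[x+z] (k / d * n) α _ ⟩
        α + (k / d * n + (β ∸ n/d) * k)  ≡⟨ cong (λ x → α + x) split-β ⟨
        α + β * k                        ≡⟨ eq ⟩
        t * n                            ≡⟨ split-t ⟩
        k / d * n + (t ∸ k / d) * n      ∎))
        where
        open ≡-Reasoning
        x+[y+z]≡y+[x+z] : ∀ x y z → x + (y + z) ≡ y + (x + z)
        x+[y+z]≡y+[x+z] = ℕ-Solver.solve-∀
      unwound (outer eq) = contradiction
        (≤-trans (m≤m+n k (β′ * k)) (≤-trans (m≤n+m (β * k) (t * n)) (≤-reflexive (sym eq)))) k≰α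
      unwound (inner eq) = inner (+-cancelˡ-≡ (k / d * n) _ _ (begin
        k / d * n + (β ∸ n/d) * k          ≡⟨ split-β ⟨
        β * k                              ≡⟨ eq ⟩
        t * n + α                          ≡⟨ cong (_+ α) split-t ⟩
        k / d * n + (t ∸ k / d) * n + α    ≡⟨ +-assoc (k / d * n) _ α ⟩
        k / d * n + ((t ∸ k / d) * n + α)  ∎))
        where open ≡-Reasoning

      odd′ : Odd (α + (β ∸ n/d))
      odd′ e = odd (subst (2 ∣_) (trans (+-assoc α (β ∸ n/d) n/d) (cong (λ x → α + x) (m∸n+n≡m n/d≤β)))
                          (∣m∣n⇒∣m+n e even-n/d))

    by-range : Dominated (α + β + 2)
    by-range with t ≤? bound | 2 ∣? n/d | t ≤? 2 * k / d | t ≤? k / d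
    ... | no  t≰ | _        | _     | _     = k+3-dominates even-k (beyond-bound (≰⇒> t≰))
    ... | yes t≤ | no  odd′ | yes p | _     =
      short-dominated (odd-even odd′ even-k 0<t (⊓-glb p t≤)) w α<k (s≤s z≤n) odd
    ... | yes _  | no  odd′ | no ¬p | _     =
      n/d-dominates-winding odd′ w (≤-trans k/d≤2k/d (<⇒≤ (≰⇒> ¬p)))
    ... | yes t≤ | yes even | _     | yes p =
      short-dominated (even-even even even-k 0<t (⊓-glb p t≤)) w α<k (s≤s z≤n) odd
    ... | yes _  | yes even | _     | no ¬p = unwind even (≰⇒> ¬p)

  winding-dominated : ∀ {t α β} → Winding t α β → Odd (α + β) → Dominated (α + β + 2)
  winding-dominated {t} w odd with 2 ∣? k
  ... | yes even-k = even-k-dominated (<-wellFounded t) even-k w odd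
  ... | no  odd-k  = odd-k-dominated odd-k w odd

  -- From walks to windings.

  open SimpleGraph Pet using (_~_)
  open Walks Pet

  -- The sign patterns of `a` and `b` correspond to the constructors of `Winding`; two negative
  -- numbers cannot yield `t n ≥ 0`.
  Winding-ℤ⁺ : ∀ t a b → a ℤ.+ b ℤ.* + k ≡ + (t * n) → Winding t ℤ.∣ a ∣ ℤ.∣ b ∣
  Winding-ℤ⁺ t (+ α) (+ β) eq =
    same (ℤ.+-injective (trans (cong (λ x → + α ℤ.+ x) (ℤ.pos-* β k)) eq))
  Winding-ℤ⁺ t (+ α) -[1+ β ] eq = outer (ℤ.+-injective (begin
    + α                                                        ≡⟨ ring (+ α) (+ suc β) (+ k) ⟩
    + α ℤ.+ (ℤ.- + suc β) ℤ.* + k ℤ.+ + suc β ℤ.* + k         ≡⟨ cong₂ ℤ._+_ eq (sym (ℤ.pos-* (suc β) k)) ⟩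
    + (t * n) ℤ.+ + (suc β * k)                                ∎))
    where
    open ≡-Reasoning
    ring : ∀ a b k → a ≡ a ℤ.+ (ℤ.- b) ℤ.* k ℤ.+ b ℤ.* k
    ring = ℤ-Solver.solve-∀
  Winding-ℤ⁺ t -[1+ α ] (+ β) eq = inner (ℤ.+-injective (begin
    + (β * k)                                          ≡⟨ ℤ.pos-* β k ⟩
    + β ℤ.* + k                                        ≡⟨ ring (+ suc α) (+ β) (+ k) ⟩
    ℤ.- + suc α ℤ.+ + β ℤ.* + k ℤ.+ + suc α            ≡⟨ cong (λ x → x ℤ.+ + suc α) eq ⟩
    + (t * n) ℤ.+ + suc α                              ∎))
    where
    open ≡-Reasoning
    ring : ∀ a b k → b ℤ.* k ≡ ℤ.- a ℤ.+ b ℤ.* k ℤ.+ a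
    ring = ℤ-Solver.solve-∀
  Winding-ℤ⁺ t -[1+ α ] -[1+ β ] eq = contradiction (ℤ.+-injective (begin
    + (suc α + (suc β * k + t * n))                               ≡⟨ cong (λ x → + suc α ℤ.+ (x ℤ.+ + (t * n))) (ℤ.pos-* (suc β) k) ⟩
    + suc α ℤ.+ (+ suc β ℤ.* + k ℤ.+ + (t * n))                   ≡⟨ cong (λ x → + suc α ℤ.+ (+ suc β ℤ.* + k ℤ.+ x)) eq ⟨
    + suc α ℤ.+ (+ suc β ℤ.* + k ℤ.+ (ℤ.- + suc α ℤ.+ (ℤ.- + suc β) ℤ.* + k)) ≡⟨ ring (+ suc α) (+ suc β) (+ k) ⟩
    0ℤ                                                            ∎)) λ ()
    where
    open ≡-Reasoning
    ring : ∀ a b k → a ℤ.+ (b ℤ.* k ℤ.+ (ℤ.- a ℤ.+ (ℤ.- b) ℤ.* k)) ≡ 0ℤ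
    ring = ℤ-Solver.solve-∀

  -- Negative `t` is reduced to positive `t` by reversing the direction of the walk, which preserves
  -- all absolute values.
  Winding-ℤ : ∀ t a b → a ℤ.+ b ℤ.* + k ≡ t ℤ.* + n → Winding ℤ.∣ t ∣ ℤ.∣ a ∣ ℤ.∣ b ∣
  Winding-ℤ (+ t)    a b eq = Winding-ℤ⁺ t a b (trans eq (sym (ℤ.pos-* t n)))
  Winding-ℤ -[1+ t ] a b eq = subst₂ (Winding (suc t)) (ℤ.∣-i∣≡∣i∣ a) (ℤ.∣-i∣≡∣i∣ b)
    (Winding-ℤ⁺ (suc t) (ℤ.- a) (ℤ.- b) (begin
      ℤ.- a ℤ.+ (ℤ.- b) ℤ.* + k             ≡⟨ ring₁ a b (+ k) ⟩
      ℤ.- (a ℤ.+ b ℤ.* + k)                 ≡⟨ cong ℤ.-_ eq ⟩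
      ℤ.- ((ℤ.- + suc t) ℤ.* + n)           ≡⟨ ring₂ (+ suc t) (+ n) ⟩
      + suc t ℤ.* + n                       ≡⟨ ℤ.pos-* (suc t) n ⟨
      + (suc t * n)                         ∎))
    where
    open ≡-Reasoning
    ring₁ : ∀ a b k → ℤ.- a ℤ.+ (ℤ.- b) ℤ.* k ≡ ℤ.- (a ℤ.+ b ℤ.* k)
    ring₁ = ℤ-Solver.solve-∀
    ring₂ : ∀ t n → ℤ.- ((ℤ.- t) ℤ.* n) ≡ t ℤ.* n
    ring₂ = ℤ-Solver.solve-∀

  index : V → ℕ
  index (u i) = toℕ i
  index (v i) = toℕ i

  layer : V → Parity
  layer (u _) = 0ℙ
  layer (v _) = 1ℙ

  -- A congruence modulo `n` with its quotient kept as data, because for a closed walk that quotient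
  -- becomes the `t` of `Winding`.
  record Displacement (x y : V) (a b : ℤ) : Set where
    constructor _,_
    field
      turns  : ℤ
      index≡ : + index y ℤ.+ turns ℤ.* + n ≡ + index x ℤ.+ (a ℤ.+ b ℤ.* + k)

  displacement-trans : ∀ {x y z a b a′ b′} → Displacement x y a b → Displacement y z a′ b′ →
                       Displacement x z (a ℤ.+ a′) (b ℤ.+ b′)
  displacement-trans {x} {y} {z} {a} {b} {a′} {b′} (s , eq) (t , eq′) = s ℤ.+ t , (begin
    + index z ℤ.+ (s ℤ.+ t) ℤ.* + n                              ≡⟨ ring₁ (+ index z) s t (+ n) ⟩
    + index z ℤ.+ t ℤ.* + n ℤ.+ s ℤ.* + n                        ≡⟨ cong (λ x → x ℤ.+ s ℤ.* + n) eq′ ⟩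
    + index y ℤ.+ (a′ ℤ.+ b′ ℤ.* + k) ℤ.+ s ℤ.* + n              ≡⟨ ring₂ (+ index y) (a′ ℤ.+ b′ ℤ.* + k) (s ℤ.* + n) ⟩
    + index y ℤ.+ s ℤ.* + n ℤ.+ (a′ ℤ.+ b′ ℤ.* + k)              ≡⟨ cong (λ x → x ℤ.+ (a′ ℤ.+ b′ ℤ.* + k)) eq ⟩
    + index x ℤ.+ (a ℤ.+ b ℤ.* + k) ℤ.+ (a′ ℤ.+ b′ ℤ.* + k)      ≡⟨ ring₃ (+ index x) a b a′ b′ (+ k) ⟩
    + index x ℤ.+ (a ℤ.+ a′ ℤ.+ (b ℤ.+ b′) ℤ.* + k)              ∎)
    where
    open ≡-Reasoning
    ring₁ : ∀ z s t n → z ℤ.+ (s ℤ.+ t) ℤ.* n ≡ z ℤ.+ t ℤ.* n ℤ.+ s ℤ.* n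
    ring₁ = ℤ-Solver.solve-∀
    ring₂ : ∀ y c s → y ℤ.+ c ℤ.+ s ≡ y ℤ.+ s ℤ.+ c
    ring₂ = ℤ-Solver.solve-∀
    ring₃ : ∀ x a b a′ b′ k → x ℤ.+ (a ℤ.+ b ℤ.* k) ℤ.+ (a′ ℤ.+ b′ ℤ.* k) ≡ x ℤ.+ (a ℤ.+ a′ ℤ.+ (b ℤ.+ b′) ℤ.* k)
    ring₃ = ℤ-Solver.solve-∀

  displacement-sym : ∀ {x y a b} → Displacement x y a b → Displacement y x (ℤ.- a) (ℤ.- b)
  displacement-sym {x} {y} {a} {b} (t , eq) = ℤ.- t , (begin
    + index x ℤ.+ (ℤ.- t) ℤ.* + n                                   ≡⟨ ring₁ (+ index x) t (+ n) (a ℤ.+ b ℤ.* + k) ⟩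
    + index x ℤ.+ (a ℤ.+ b ℤ.* + k) ℤ.- t ℤ.* + n ℤ.- (a ℤ.+ b ℤ.* + k)   ≡⟨ cong (λ x → x ℤ.- t ℤ.* + n ℤ.- (a ℤ.+ b ℤ.* + k)) eq ⟨
    + index y ℤ.+ t ℤ.* + n ℤ.- t ℤ.* + n ℤ.- (a ℤ.+ b ℤ.* + k)     ≡⟨ ring₂ (+ index y) t (+ n) a b (+ k) ⟩
    + index y ℤ.+ (ℤ.- a ℤ.+ (ℤ.- b) ℤ.* + k)                       ∎)
    where
    open ≡-Reasoning
    ring₁ : ∀ x t n c → x ℤ.+ (ℤ.- t) ℤ.* n ≡ x ℤ.+ c ℤ.- t ℤ.* n ℤ.- c
    ring₁ = ℤ-Solver.solve-∀
    ring₂ : ∀ y t n a b k → y ℤ.+ t ℤ.* n ℤ.- t ℤ.* n ℤ.- (a ℤ.+ b ℤ.* k) ≡ y ℤ.+ (ℤ.- a ℤ.+ (ℤ.- b) ℤ.* k)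
    ring₂ = ℤ-Solver.solve-∀

  ⊕-displacement : ∀ (i : Fin n) j → + toℕ (i ⊕ j) ℤ.+ + ((toℕ i + j) / n) ℤ.* + n ≡ + toℕ i ℤ.+ + j
  ⊕-displacement i j = trans
    (cong₂ (λ x y → + x ℤ.+ y) (toℕ-⊕ i j) (sym (ℤ.pos-* ((toℕ i + j) / n) n)))
    (cong (λ x → + x) (sym (m≡m%n+[m/n]*n (toℕ i + j) n)))

  uu-displacement : ∀ i → Displacement (u i) (u (i ⊕ 1)) 1ℤ 0ℤ
  uu-displacement i = + ((toℕ i + 1) / n) , ⊕-displacement i 1

  vv-displacement : ∀ i → Displacement (v i) (v (i ⊕ k)) 0ℤ 1ℤ
  vv-displacement i = + ((toℕ i + k) / n) ,
    trans (⊕-displacement i k) (cong (λ x → + toℕ i ℤ.+ x) (sym (trans (ℤ.+-identityˡ _) (ℤ.*-identityˡ (+ k)))))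

  zero-displacement : ∀ {x y} → index x ≡ index y → Displacement x y 0ℤ 0ℤ
  zero-displacement eq = 0ℤ , cong (λ x → + x ℤ.+ 0ℤ) (sym eq)

  -- a and b are the net numbers of outer and inner steps, c the number of
  -- spokes, and e the number of pairs of mutually cancelling steps.
  record Account (x y : V) (ℓ : ℕ) : Set where
    field
      a b           : ℤ
      c e           : ℕ
      displacement  : Displacement x y a b
      length≡       : ℓ ≡ ℤ.∣ a ∣ + ℤ.∣ b ∣ + c + (e + e)
      spokes        : parity c ≡ layer x ℙ.+ layer y
      spokeless     : c ≡ 0 → (layer x ≡ 0ℙ × b ≡ 0ℤ) ⊎ (layer x ≡ 1ℙ × a ≡ 0ℤ)

  outer-step : ∀ {x y z ℓ δ} → ℤ.∣ δ ∣ ≡ 1 → layer x ≡ 0ℙ → layer y ≡ 0ℙ → Displacement x y δ 0ℤ →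
               Account y z ℓ → Account x z (suc ℓ)
  outer-step {x} {y} {z} {ℓ} {δ} ∣δ∣≡1 x∈u y∈u xy A with suc-∣∣ δ (Account.a A) ∣δ∣≡1
  ... | e′ , eq = record
    { a = δ ℤ.+ a ; b = b ; c = c ; e = e′ + e
    ; displacement = subst (Displacement x z (δ ℤ.+ a)) (ℤ.+-identityˡ b)
                           (displacement-trans xy displacement)
    ; length≡ = begin
        suc ℓ                                              ≡⟨ cong suc length≡ ⟩
        suc ℤ.∣ a ∣ + ℤ.∣ b ∣ + c + (e + e)                    ≡⟨ cong (λ x → x + ℤ.∣ b ∣ + c + (e + e)) eq ⟩
        ℤ.∣ δ ℤ.+ a ∣ + (e′ + e′) + ℤ.∣ b ∣ + c + (e + e)      ≡⟨ ring ℤ.∣ δ ℤ.+ a ∣ ℤ.∣ b ∣ c e e′ ⟩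
        ℤ.∣ δ ℤ.+ a ∣ + ℤ.∣ b ∣ + c + (e′ + e + (e′ + e))      ∎
    ; spokes = trans spokes (cong (ℙ._+ layer z) (trans y∈u (sym x∈u)))
    ; spokeless = λ c≡0 → stay (spokeless c≡0)
    }
    where
    open Account A
    open ≡-Reasoning
    ring : ∀ a b c e e′ → a + (e′ + e′) + b + c + (e + e) ≡ a + b + c + (e′ + e + (e′ + e))
    ring = ℕ-Solver.solve-∀
    stay : (layer y ≡ 0ℙ × b ≡ 0ℤ) ⊎ (layer y ≡ 1ℙ × a ≡ 0ℤ) →
           (layer x ≡ 0ℙ × b ≡ 0ℤ) ⊎ (layer x ≡ 1ℙ × δ ℤ.+ a ≡ 0ℤ)
    stay (inj₁ (_ , b≡0))  = inj₁ (x∈u , b≡0)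
    stay (inj₂ (y∈v , _)) with () ← trans (sym y∈u) y∈v

  inner-step : ∀ {x y z ℓ δ} → ℤ.∣ δ ∣ ≡ 1 → layer x ≡ 1ℙ → layer y ≡ 1ℙ → Displacement x y 0ℤ δ →
               Account y z ℓ → Account x z (suc ℓ)
  inner-step {x} {y} {z} {ℓ} {δ} ∣δ∣≡1 x∈v y∈v xy A with suc-∣∣ δ (Account.b A) ∣δ∣≡1
  ... | e′ , eq = record
    { a = a ; b = δ ℤ.+ b ; c = c ; e = e′ + e
    ; displacement = subst (λ a → Displacement x z a (δ ℤ.+ b)) (ℤ.+-identityˡ a)
                           (displacement-trans xy displacement)
    ; length≡ = begin
        suc ℓ                                              ≡⟨ cong suc length≡ ⟩
        suc (ℤ.∣ a ∣ + ℤ.∣ b ∣ + c + (e + e))                  ≡⟨ cong (λ x → x + c + (e + e)) (+-suc ℤ.∣ a ∣ ℤ.∣ b ∣) ⟨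
        ℤ.∣ a ∣ + suc ℤ.∣ b ∣ + c + (e + e)                    ≡⟨ cong (λ x → ℤ.∣ a ∣ + x + c + (e + e)) eq ⟩
        ℤ.∣ a ∣ + (ℤ.∣ δ ℤ.+ b ∣ + (e′ + e′)) + c + (e + e)    ≡⟨ ring ℤ.∣ a ∣ ℤ.∣ δ ℤ.+ b ∣ c e e′ ⟩
        ℤ.∣ a ∣ + ℤ.∣ δ ℤ.+ b ∣ + c + (e′ + e + (e′ + e))      ∎
    ; spokes = trans spokes (cong (ℙ._+ layer z) (trans y∈v (sym x∈v)))
    ; spokeless = λ c≡0 → stay (spokeless c≡0)
    }
    where
    open Account A
    open ≡-Reasoning
    ring : ∀ a b c e e′ → a + (b + (e′ + e′)) + c + (e + e) ≡ a + b + c + (e′ + e + (e′ + e))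
    ring = ℕ-Solver.solve-∀
    stay : (layer y ≡ 0ℙ × b ≡ 0ℤ) ⊎ (layer y ≡ 1ℙ × a ≡ 0ℤ) →
           (layer x ≡ 0ℙ × δ ℤ.+ b ≡ 0ℤ) ⊎ (layer x ≡ 1ℙ × a ≡ 0ℤ)
    stay (inj₁ (y∈u , _)) with () ← trans (sym y∈v) y∈u
    stay (inj₂ (_ , a≡0))  = inj₂ (x∈v , a≡0)

  spoke-step : ∀ {x y z ℓ} → layer x ≡ layer y ℙ.⁻¹ → index x ≡ index y →
               Account y z ℓ → Account x z (suc ℓ)
  spoke-step {x} {y} {z} {ℓ} flip eq A = record
    { a = a ; b = b ; c = suc c ; e = e
    ; displacement = subst₂ (Displacement x z) (ℤ.+-identityˡ a) (ℤ.+-identityˡ b)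
                            (displacement-trans (zero-displacement eq) displacement)
    ; length≡ = trans (cong suc length≡) (cong (_+ (e + e)) (sym (+-suc (ℤ.∣ a ∣ + ℤ.∣ b ∣) c)))
    ; spokes = begin
        parity (suc c)                     ≡⟨ parity-suc c ⟩
        1ℙ ℙ.+ parity c                    ≡⟨ cong ℙ._⁻¹ spokes ⟩
        1ℙ ℙ.+ (layer y ℙ.+ layer z)       ≡⟨ ℙ.+-assoc 1ℙ (layer y) (layer z) ⟨
        layer y ℙ.⁻¹ ℙ.+ layer z           ≡⟨ cong (ℙ._+ layer z) flip ⟨
        layer x ℙ.+ layer z                ∎
    ; spokeless = λ ()
    }
    where
    open Account A
    open ≡-Reasoning

  account : ∀ {x y ℓ} → Walk x y ℓ → Account x y ℓ
  account {x} [] = record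
    { a = 0ℤ ; b = 0ℤ ; c = 0 ; e = 0
    ; displacement = zero-displacement refl
    ; length≡ = refl
    ; spokes = loop (layer x)
    ; spokeless = λ _ → either (layer x)
    }
    where
    loop : ∀ p → 0ℙ ≡ p ℙ.+ p
    loop 0ℙ = refl
    loop 1ℙ = refl
    either : ∀ p → (p ≡ 0ℙ × 0ℤ ≡ 0ℤ) ⊎ (p ≡ 1ℙ × 0ℤ ≡ 0ℤ)
    either 0ℙ = inj₁ (refl , refl)
    either 1ℙ = inj₂ (refl , refl)
  account (fwd (uu i) ∷ w) = outer-step refl refl refl (uu-displacement i) (account w)
  account (bwd (uu i) ∷ w) = outer-step refl refl refl
    (displacement-sym (uu-displacement i)) (account w)
  account (fwd (vv i) ∷ w) = inner-step refl refl refl (vv-displacement i) (account w)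
  account (bwd (vv i) ∷ w) = inner-step refl refl refl
    (displacement-sym (vv-displacement i)) (account w)
  account (fwd (uv i) ∷ w) = spoke-step refl refl (account w)
  account (bwd (uv i) ∷ w) = spoke-step refl refl (account w)

  -- A closed walk returns to its layer, so its number of spokes is even: either zero, and the walk
  -- stays in one layer, or at least two, which accounts for the summand 2.
  closed-dominated : ∀ {x ℓ} → Walk x x ℓ → Odd ℓ → Dominated ℓ
  closed-dominated {x} {ℓ} w odd = by-spokes c refl
    where
    open Account (account w)

    even-c : Even c
    even-c = parity≡0⇒even c (trans spokes (double (layer x)))
      where
      double : ∀ p → p ℙ.+ p ≡ 0ℙ
      double 0ℙ = refl
      double 1ℙ = refl

    winding : Winding ℤ.∣ Displacement.turns displacement ∣ ℤ.∣ a ∣ ℤ.∣ b ∣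
    winding with t , eq ← displacement =
      Winding-ℤ t a b (sym (∙-cancelˡ ℤ.+-0-abelianGroup (+ index x) _ _ eq))

    odd-a+b : Odd (ℤ.∣ a ∣ + ℤ.∣ b ∣)
    odd-a+b even = odd (subst (2 ∣_) (sym length≡)
      (∣m∣n⇒∣m+n (∣m∣n⇒∣m+n even even-c) (subst (2 ∣_) (cong (λ x → e + x) (+-identityʳ e)) (m∣m*n e))))

    a+b+c≤ℓ : ℤ.∣ a ∣ + ℤ.∣ b ∣ + c ≤ ℓ
    a+b+c≤ℓ = subst (ℤ.∣ a ∣ + ℤ.∣ b ∣ + c ≤_) (sym length≡) (m≤m+n _ (e + e))

    by-spokes : ∀ c′ → c ≡ c′ → Dominated ℓ
    by-spokes 0 c≡0 = dominated-mono (≤-trans (m≤m+n _ c) a+b+c≤ℓ)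
      (one-layer-dominated winding odd-a+b (one (spokeless c≡0)))
      where
      one : (layer x ≡ 0ℙ × b ≡ 0ℤ) ⊎ (layer x ≡ 1ℙ × a ≡ 0ℤ) → ℤ.∣ a ∣ ≡ 0 ⊎ ℤ.∣ b ∣ ≡ 0
      one (inj₁ (_ , b≡0)) = inj₂ (cong ℤ.∣_∣ b≡0)
      one (inj₂ (_ , a≡0)) = inj₁ (cong ℤ.∣_∣ a≡0)
    by-spokes 1 c≡1 = contradiction (subst (2 ∣_) c≡1 even-c) (parity≡1⇒odd {1} refl)
    by-spokes (suc (suc c′)) c≡ = dominated-mono
      (≤-trans (+-monoʳ-≤ (ℤ.∣ a ∣ + ℤ.∣ b ∣) (subst (2 ≤_) (sym c≡) (s≤s (s≤s z≤n)))) a+b+c≤ℓ)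
      (winding-dominated winding odd-a+b)

  -- Closed walks realising the candidates.

  point : ℕ → Fin n
  point m = m mod n

  point-wrap : ∀ m t → point (m + t * n) ≡ point m
  point-wrap m t = fromℕ<-cong _ _ ([m+kn]%n≡m%n m t n) _ _

  outer-path : ∀ m r → Walk (u (point m)) (u (point (m + r))) r
  outer-path m r = path (λ i → u (point i)) step m r
    where
    step : ∀ i → u (point i) ~ u (point (suc i))
    step i = subst (λ j → u (point i) ~ u j)
      (trans (mod-⊕ i 1 n) (cong point (+-comm i 1))) (fwd (uu (point i)))

  inner-path : ∀ m q → Walk (v (point m)) (v (point (q * k + m))) q
  -- With the multiple of `k` in front, the vertex for `i = 0` computes to `v (point m)`.
  inner-path m q = path (λ i → v (point (i * k + m))) step 0 q
    where
    step : ∀ i → v (point (i * k + m)) ~ v (point (suc i * k + m))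
    step i = subst (λ j → v (point (i * k + m)) ~ v j)
      (trans (mod-⊕ (i * k + m) k n) (cong point (rotate (i * k) m k))) (fwd (vv (point (i * k + m))))
      where
      rotate : ∀ x y z → x + y + z ≡ z + x + y
      rotate = ℕ-Solver.solve-∀

  ClosedWalk : ℕ → Set
  ClosedWalk ℓ = ∃[ x ] Walk x x ℓ

  length+2 : ∀ α β → α + suc (β + 1) ≡ α + β + 2
  length+2 = ℕ-Solver.solve-∀

  -- Outer steps forward, a spoke, inner steps forward and a spoke back; the total shift is `t n`.
  floor-closed : ∀ {t α β} → α + β * k ≡ t * n → ClosedWalk (α + β + 2)
  floor-closed {t} {α} {β} eq = _ , subst (Walk (u (point 0)) (u (point 0))) (length+2 α β)
    (outer-path 0 α ++ fwd (uv (point α)) ∷ inner-path α β ++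
     subst (λ i → v i ~ u (point 0)) (sym end) (bwd (uv (point 0))) ∷ [])
    where
    end : point (β * k + α) ≡ point 0
    end = trans (cong point (trans (+-comm (β * k) α) eq)) (point-wrap 0 t)

  -- The inner steps overshoot `t n` by `α`, and the outer path, traversed backwards between two
  -- spokes, makes up for it.
  ceiling-closed : ∀ {t α β} → β * k ≡ t * n + α → ClosedWalk (α + β + 2)
  ceiling-closed {t} {α} {β} eq = _ , subst (Walk (v (point 0)) (v (point 0)))
    (trans (length+2 β α) (cong (_+ 2) (+-comm β α)))
    (inner-path 0 β ++
     bwd (uv (point (β * k + 0))) ∷
     subst (λ i → Walk (u i) (u (point (t * n))) α)
           (cong point (sym (trans (+-identityʳ (β * k)) eq)))
           (reverse (outer-path (t * n) α)) ++
     subst (λ i → u (point (t * n)) ~ v i) (point-wrap 0 t) (fwd (uv (point (t * n)))) ∷ [])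

  n/d-closed : ClosedWalk n/d
  n/d-closed = _ , subst (λ i → Walk (v (point 0)) (v i) n/d)
    (trans (cong point (trans (+-identityʳ (n/d * k)) n/d*k≡k/d*n)) (point-wrap 0 (k / d)))
    (inner-path 0 n/d)

  -- Besides realising each candidate as a length, this shows that no candidate is negative, so the
  -- minimum may be sought in ℕ.
  candidate-closed : ∀ {z} → z ∈ Candidates → ∃[ m ] z ≡ + m × ClosedWalk m
  candidate-closed (inj₁ refl , _) = n/d , refl , n/d-closed
  candidate-closed (inj₂ (inj₁ refl) , _) =
    -- One inner step undone by `k` outer steps: no turns, `α = k` and `β = 1`.
    k + 3 , refl , subst ClosedWalk (+-assoc k 1 2) (ceiling-closed {0} {k} {1} (+-identityʳ k))
  candidate-closed (inj₂ (inj₂ ((t , _) , inj₁ refl)) , _) =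
    _ , floor-value {t} (floor-winding t) refl , floor-closed {t} {t * n % k} (floor-winding t)
  candidate-closed (inj₂ (inj₂ ((t , _) , inj₂ refl)) , _) =
    _ , ceiling-value {t} (ceiling-winding t) refl , ceiling-closed {t} (ceiling-winding t)

  -- Decidability of the candidates and their minimum.

  odd? : Decidable Odd
  odd? m = ¬? (2 ∣? m)

  ind? : Decidable Ind
  ind? t
    with odd? k ×-dec odd? n ×-dec odd? t ×-dec t ≤? (2 * k / d) ⊓ (⌊ (k ∸ 1) ^ 2 / n ⌋ + 1)
       | odd? n/d ×-dec 2 ∣? k ×-dec 0 <? t ×-dec t ≤? (2 * k / d) ⊓ ⌊ (k ∸ 1) ^ 2 / n ⌋
       | 2 ∣? n/d ×-dec 2 ∣? k ×-dec 0 <? t ×-dec t ≤? (k / d) ⊓ ⌊ (k ∸ 1) ^ 2 / n ⌋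
  ... | yes (p , q , r , s) | _ | _ = yes (odd-odd p q r s)
  ... | _ | yes (p , q , r , s) | _ = yes (odd-even p q r s)
  ... | _ | _ | yes (p , q , r , s) = yes (even-even p q r s)
  ... | no ¬oo | no ¬oe | no ¬ee = no λ where
    (odd-odd p q r s)   → ¬oo (p , q , r , s)
    (odd-even p q r s)  → ¬oe (p , q , r , s)
    (even-even p q r s) → ¬ee (p , q , r , s)

  -- A uniform bound on the indices turns the union in `𝒢` into a finite search.
  Ind⇒≤2k : ∀ {t} → Ind t → t ≤ 2 * k
  Ind⇒≤2k (odd-odd _ _ _ t≤)   = ≤-trans (m≤n⊓o⇒m≤n _ _ t≤) (m/n≤m (2 * k) d)
  Ind⇒≤2k (odd-even _ _ _ t≤)  = ≤-trans (m≤n⊓o⇒m≤n _ _ t≤) (m/n≤m (2 * k) d)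
  Ind⇒≤2k (even-even _ _ _ t≤) = ≤-trans (m≤n⊓o⇒m≤n _ _ t≤) (≤-trans k/d≤2k/d (m/n≤m (2 * k) d))

  𝒢? : Decidable 𝒢
  𝒢? z = map′ (λ (t , _ , ind , eq) → (t , ind) , eq)
              (λ ((t , ind) , eq) → t , s≤s (Ind⇒≤2k ind) , ind , eq)
              (anyUpTo? (λ t → ind? t ×-dec (_ ℤ.≟ z ⊎-dec _ ℤ.≟ z)) (suc (2 * k)))

  candidate? : Decidable Candidates
  candidate? z = ((+ n/d) ℤ.≟ z ⊎-dec (+ (k + 3)) ℤ.≟ z ⊎-dec 𝒢? z) ×-dec odd? ℤ.∣ z ∣

  some-candidate : ¬ (Even n × Odd k) → ∃[ m ] + m ∈ Candidates
  some-candidate ¬bip with 2 ∣? k | 2 ∣? n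
  ... | yes even-k | _          with m , m∈ , _ ← k+3-dominates even-k ≤-refl = m , m∈
  ... | no  odd-k  | yes even-n = contradiction (even-n , odd-k) ¬bip
  ... | no  odd-k  | no  odd-n  = n/d , inj₁ refl , λ e → odd-n (∣-trans e n/d∣n)

  -- The least candidate `g` is the length of a closed walk, and every odd closed walk is at least
  -- as long as some candidate. So `g` is the length of a shortest odd closed walk, which is a
  -- cycle.
  odd-girth : ∃[ m ] + m ∈ Candidates → ∃[ g ] IsOddGirth Pet g × IsLeast ℤ._≤_ Candidates (+ g)
  odd-girth (m , m∈) with g , isLeast ← least (λ m → candidate? (+ m)) m∈ = g ,
      record { member = odd-g , shortest-odd-closed⇒cycle (proj₂ g-closed) odd-g shortest
             ; least  = λ (odd , c) → shortest (proj₂ (cycle⇒closed c)) odd } ,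
      record { member = member ; least = ≤-candidate }
    where
    open IsLeast isLeast renaming (least to g≤)
    odd-g : Odd g
    odd-g = proj₂ member
    g-closed : ClosedWalk g
    g-closed with m , eq , w ← candidate-closed member = subst ClosedWalk (sym (ℤ.+-injective eq)) w
    shortest : ∀ {x m} → Walk x x m → Odd m → g ≤ m
    shortest w odd with m , m∈ , m≤ ← closed-dominated w odd = ≤-trans (g≤ m∈) m≤
    ≤-candidate : ∀ {z} → z ∈ Candidates → + g ℤ.≤ z
    ≤-candidate z∈ with m , refl , _ ← candidate-closed z∈ = ℤ.+≤+ (g≤ z∈)

  odd-closed : ¬ (Even n × Odd k) → ∃[ ℓ ] Odd ℓ × ClosedWalk ℓ
  odd-closed ¬bip with m , m∈ ← some-candidate ¬bip with ℓ , eq , w ← candidate-closed m∈ =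
    m , proj₂ m∈ , subst ClosedWalk (sym (ℤ.+-injective eq)) w

  -- Bipartiteness.

  bipartite : Even n × Odd k → Bipartite Pet
  bipartite (even-n , odd-k) = (λ x → toBool (colour x)) , λ e eq → proper e (toBool-injective eq)
    where
    toBool : Parity → Bool
    toBool 0ℙ = false
    toBool 1ℙ = true

    toBool-injective : ∀ {p q} → toBool p ≡ toBool q → p ≡ q
    toBool-injective {0ℙ} {0ℙ} _ = refl
    toBool-injective {1ℙ} {1ℙ} _ = refl

    -- The inner layer is coloured oppositely, for the spokes; steps of length 1 and of odd length
    -- `k` change the parity of the index.
    colour : V → Parity
    colour (u i) = parity (toℕ i)
    colour (v i) = parity (toℕ i) ℙ.⁻¹

    ≢⁻¹ : ∀ p → p ≢ p ℙ.⁻¹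
    ≢⁻¹ 0ℙ ()
    ≢⁻¹ 1ℙ ()

    -- Reduction modulo the even number `n` preserves parity, so the colouring is consistent across
    -- the wrap-around.
    parity-%n : ∀ m → parity (m % n) ≡ parity m
    parity-%n m = begin
      parity (m % n)                               ≡⟨ ℙ.+-identityʳ _ ⟨
      parity (m % n) ℙ.+ 0ℙ                        ≡⟨ cong (parity (m % n) ℙ.+_) (even⇒parity≡0 (∣n⇒∣m*n (m / n) even-n)) ⟨
      parity (m % n) ℙ.+ parity (m / n * n)        ≡⟨ ℙ.+-homo-+ (m % n) (m / n * n) ⟨
      parity (m % n + m / n * n)                   ≡⟨ cong parity (m≡m%n+[m/n]*n m n) ⟨
      parity m                                     ∎
      where open ≡-Reasoning

    flip : ∀ (i : Fin n) {j} → Odd j → parity (toℕ (i ⊕ j)) ≡ parity (toℕ i) ℙ.⁻¹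
    flip i {j} odd-j = begin
      parity (toℕ (i ⊕ j))              ≡⟨ cong parity (toℕ-⊕ i j) ⟩
      parity ((toℕ i + j) % n)          ≡⟨ parity-%n (toℕ i + j) ⟩
      parity (toℕ i + j)                ≡⟨ cong parity (+-comm (toℕ i) j) ⟩
      parity (j + toℕ i)                ≡⟨ ℙ.+-homo-+ j (toℕ i) ⟩
      parity j ℙ.+ parity (toℕ i)       ≡⟨ cong (ℙ._+ parity (toℕ i)) (odd⇒parity≡1 odd-j) ⟩
      parity (toℕ i) ℙ.⁻¹               ∎
      where open ≡-Reasoning

    proper-edge : ∀ {x y} → Edge x y → colour x ≢ colour y
    proper-edge (uu i) eq = ≢⁻¹ _ (trans eq (flip i (parity≡1⇒odd {1} refl)))
    proper-edge (uv i) eq = ≢⁻¹ _ eq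
    proper-edge (vv i) eq = ≢⁻¹ _ (trans eq (cong ℙ._⁻¹ (flip i odd-k)))

    proper : ∀ {x y} → x ~ y → colour x ≢ colour y
    proper (fwd e) eq = proper-edge e eq
    proper (bwd e) eq = proper-edge e (sym eq)

  not-bipartite⇔ : (¬ Bipartite Pet) ⇔ (¬ (Even n × Odd k))
  not-bipartite⇔ = mk⇔ (λ ¬bip eo → ¬bip (bipartite eo)) from
    where
    from : ¬ (Even n × Odd k) → ¬ Bipartite Pet
    from ¬eo bip with ℓ , odd , _ , w ← odd-closed ¬eo = odd (bipartite⇒even-closed bip w)

theorem1 : ∀ (n k : ℕ) (2<2k : 2 < 2 * k) (2k≤n : 2 * k ≤ n) →
    let open GeneralizedPetersen n k 2<2k 2k≤n in
    ((¬ Bipartite Pet) ⇔ (¬ (Even n × Odd k)))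
    × (¬ Bipartite Pet →
    ∃[ g ] IsOddGirth Pet g
    × IsLeast ℤ._≤_ ((｛ + n/d ｝ ∪ ｛ + (k + 3) ｝ ∪ 𝒢) ∩ 𝕆) (+ g))
theorem1 n k 2<2k 2k≤n =
  not-bipartite⇔ , λ ¬bip → odd-girth (some-candidate (Equivalence.to not-bipartite⇔ ¬bip))
  where open Petersen n k 2<2k 2k≤n
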